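{- Let $G=(V,E)$ be a simple undirected graph with $V=\{v_1,\ldots,v_n\}$, let $K=\{v_1,\ldots,v_k\}$ with $k>1$, and assume that $K$ is an independent set, that each $v_i\in K$ has degree exactly $2$ with $N(v_i)=\{v_{k+2i-1},v_{k+2i}\}$ for $i\in[k]$, and that no two vertices of $K$ have a common neighbour. For each edge $v_iv_j\in E$ with $i<j$ let $x_{ij}$ be a distinct commuting indeterminate, and work over a field of characteristic two (e.g. $\mathrm{GF}(2^\ell)$). Define the $n\times n$ matrix $M_G$ with polynomial entries by: for $i\neq j$, $M_G(i,j)=x_{\min(i,j)\max(i,j)}$ if $v_iv_j\in E$ and $M_G(i,j)=0$ otherwise; $M_G(i,i)=1$ for $i>3k$ and $M_G(i,i)=0$ for $i\le 3k$; and finally the two entries $M_G(1,k+2)$ and $M_G(k+1,1)$ are set to $0$ (while $M_G(1,k+1)$ and $M_G(k+2,1)$ are left unchanged). Let $T=\{x_{i,k+2i-1},x_{i,k+2i}: i\in[k]\}$ and $t=\prod_{x\in T}x$. Then $G$ has a $K$-cycle if and only if $\det M_G$, viewed as a polynomial in the indeterminates $x_{ij}$, contains a monomial $m$ with non-zero coefficient such that $t$ divides $m$.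
   Context: A $K$-cycle in $G$ is a (simple) cycle in $G$ passing through every vertex of $K$ (possibly also through other vertices). $N(v)$ denotes the set of neighbours of $v$, and $[k]=\{1,\ldots,k\}$. -}

module Defs where

open import Level using (Level; _⊔_) renaming (suc to lsuc)
open import Algebra.Bundles using (CommutativeRing)
open import Data.Nat as ℕ using (ℕ; zero; suc; _<_; _≤_)
open import Data.Fin using (Fin; toℕ; punchIn) renaming (zero to fzero; suc to fsuc)
open import Data.Fin.Properties using () renaming (_≟_ to _≟ᶠ_)
open import Data.Vec using (Vec; replicate; zipWith; tabulate)
open import Data.Vec.Properties using (≡-dec)
open import Data.List using (List; []; _∷_; _++_; map; concatMap; foldr; length)
open import Data.List.Relation.Unary.Unique.Propositional using (Unique)
open import Data.List.Relation.Unary.Linked using (Linked)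
open import Data.List.Membership.Propositional using (_∈_)
open import Data.Product using (Σ; ∃; _×_; _,_)
open import Data.Sum using (_⊎_)
open import Data.Bool using (Bool; true; false; if_then_else_)
open import Relation.Nullary using (¬_; Dec; yes; no)
open import Relation.Binary using (Decidable)
open import Relation.Binary.PropositionalEquality using (_≡_)

record Field (c ℓ : Level) : Set (lsuc (c ⊔ ℓ)) where
  field
    commutativeRing : CommutativeRing c ℓ
  open CommutativeRing commutativeRing public
  field
    1≉0     : ¬ (1# ≈ 0#)
    inverse : ∀ x → ¬ (x ≈ 0#) → Σ Carrier λ y → (x * y) ≈ 1#

HasCharTwo : ∀ {c ℓ} → Field c ℓ → Set ℓ
HasCharTwo F = (1# + 1#) ≈ 0#
  where open Field F

-- Finite simple undirected graphs on vertex set Fin n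
-- (vertex v_i of the paper is the element i-1 of Fin n)

record SimpleGraph (n : ℕ) : Set₁ where
  field
    Adj     : Fin n → Fin n → Set
    adj?    : Decidable Adj
    sym     : ∀ {u v} → Adj u v → Adj v u
    irrefl  : ∀ {u} → ¬ Adj u u

lastOf : ∀ {a} {A : Set a} → A → List A → A
lastOf x []       = x
lastOf x (y ∷ ys) = lastOf y ys

record Cycle {n : ℕ} (G : SimpleGraph n) : Set where
  open SimpleGraph G
  field
    first   : Fin n
    rest    : List (Fin n)
    long    : 2 ≤ length rest
    distinct : Unique (first ∷ rest)
    path    : Linked Adj (first ∷ rest)
    closing : Adj (lastOf first rest) first

  vertices : List (Fin n)
  vertices = first ∷ rest

KCycle : ∀ {n} → SimpleGraph n → ℕ → Set
KCycle {n} G k = Σ (Cycle G) λ C → ∀ (u : Fin n) → toℕ u < k → u ∈ Cycle.vertices C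

-- Multivariate polynomials with indeterminates x_{ij}, indexed by pairs of
-- vertices (only the x_{ij} with i<j and v_i v_j ∈ E are ever used).
-- A monomial is its exponent vector; a polynomial is a finite formal sum of
-- terms (coefficient , monomial); its coefficient function is `coeff`.

Mono : ℕ → Set
Mono n = Vec (Vec ℕ n) n

oneMono : ∀ {n} → Mono n
oneMono = replicate _ (replicate _ 0)

varMono : ∀ {n} → Fin n → Fin n → Mono n
varMono i j = tabulate λ a → tabulate λ b →
  if isYes (a ≟ᶠ i) then (if isYes (b ≟ᶠ j) then 1 else 0) else 0
  where
    isYes : ∀ {p} {P : Set p} → Dec P → Bool
    isYes (yes _) = true
    isYes (no _)  = false

mulMono : ∀ {n} → Mono n → Mono n → Mono n
mulMono = zipWith (zipWith ℕ._+_)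

_∣ₘ_ : ∀ {n} → Mono n → Mono n → Set
_∣ₘ_ {n} m₁ m₂ = ∀ (a b : Fin n) →
  Data.Vec.lookup (Data.Vec.lookup m₁ a) b ≤ Data.Vec.lookup (Data.Vec.lookup m₂ a) b

_≟ₘ_ : ∀ {n} → (m₁ m₂ : Mono n) → Dec (m₁ ≡ m₂)
_≟ₘ_ = ≡-dec (≡-dec ℕ._≟_)

module Polynomials {c ℓ} (F : Field c ℓ) where
  open Field F

  Poly : ℕ → Set c
  Poly n = List (Carrier × Mono n)

  module _ {n : ℕ} where
    const : Carrier → Poly n
    const a = (a , oneMono) ∷ []

    var : Fin n → Fin n → Poly n
    var i j = (1# , varMono i j) ∷ []

    zeroP oneP : Poly n
    zeroP = []
    oneP  = const 1#

    _+ₚ_ : Poly n → Poly n → Poly n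
    _+ₚ_ = _++_

    -ₚ_ : Poly n → Poly n
    -ₚ_ = map λ { (a , m) → (- a , m) }

    _*ₚ_ : Poly n → Poly n → Poly n
    p *ₚ q = concatMap (λ { (a , m) → map (λ { (b , m') → (a * b , mulMono m m') }) q }) p

    coeff : Mono n → Poly n → Carrier
    coeff m = foldr (λ { (a , m') s → f a (m' ≟ₘ m) + s }) 0#
      where
        f : ∀ {P : Set} → Carrier → Dec P → Carrier
        f a (yes _) = a
        f a (no _)  = 0#

  det : ∀ {r n} → (Fin r → Fin r → Poly n) → Poly n
  det {zero}  M = oneP
  det {suc r} {n} M = go (suc r) (λ j → j) true
    where
      minor : Fin (suc r) → Fin r → Fin r → Poly n
      minor j a b = M (fsuc a) (punchIn j b)
      go : (m : ℕ) → (Fin m → Fin (suc r)) → Bool → Poly n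
      go zero    col s = zeroP
      go (suc m) col s =
        (if s then term else -ₚ term) +ₚ go m (λ x → col (fsuc x)) (Data.Bool.not s)
        where
          term = M fzero (col fzero) *ₚ det (minor (col fzero))

-- Hypotheses of Theorem 7 (0-based: v_i ↦ i-1, so K = {u | toℕ u < k},
-- and N(v_i) = {v_{k+2i-1}, v_{k+2i}} becomes N(u) = {k+2u, k+2u+1}).

module _ {n : ℕ} (G : SimpleGraph n) (k : ℕ) where
  open SimpleGraph G

  InK : Fin n → Set
  InK u = toℕ u < k

  KIndependent : Set
  KIndependent = ∀ u v → InK u → InK v → ¬ Adj u v

  KNeighbourhoods : Set
  KNeighbourhoods = ∀ u v → InK u →
    (Adj u v → (toℕ v ≡ k ℕ.+ 2 ℕ.* toℕ u ⊎ toℕ v ≡ k ℕ.+ 2 ℕ.* toℕ u ℕ.+ 1))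
    × ((toℕ v ≡ k ℕ.+ 2 ℕ.* toℕ u ⊎ toℕ v ≡ k ℕ.+ 2 ℕ.* toℕ u ℕ.+ 1) → Adj u v)

  KNoCommonNeighbour : Set
  KNoCommonNeighbour = ∀ u v w → InK u → InK v → ¬ (u ≡ v) → ¬ (Adj u w × Adj v w)

tMono : (n k : ℕ) → Mono n
tMono n k = tabulate λ u → tabulate λ v →
  if isYes (toℕ u ℕ.<? k)
  then (if isYes (toℕ v ℕ.≟ k ℕ.+ 2 ℕ.* toℕ u) then 1
        else if isYes (toℕ v ℕ.≟ k ℕ.+ 2 ℕ.* toℕ u ℕ.+ 1) then 1 else 0)
  else 0
  where
    isYes : ∀ {P : Set} → Dec P → Bool
    isYes (yes _) = true
    isYes (no _)  = false

module _ {c ℓ} (F : Field c ℓ) where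
  open Polynomials F

  MG : ∀ {n} → SimpleGraph n → ℕ → Fin n → Fin n → Poly n
  MG {n} G k a b with a ≟ᶠ b
  ... | yes _ = if isYes (3 ℕ.* k ℕ.≤? toℕ a) then oneP else zeroP
    where
      isYes : ∀ {P : Set} → Dec P → Bool
      isYes (yes _) = true
      isYes (no _)  = false
  ... | no _ with toℕ a ℕ.≟ 0 | toℕ b ℕ.≟ k ℕ.+ 1 | toℕ a ℕ.≟ k | toℕ b ℕ.≟ 0
  ...   | yes _ | yes _ | _     | _     = zeroP
  ...   | _     | _     | yes _ | yes _ = zeroP
  ...   | _     | _     | _     | _     with SimpleGraph.adj? G a b
  ...     | no _  = zeroP
  ...     | yes _ with toℕ a ℕ.<? toℕ b
  ...       | yes _ = var a b
  ...       | no _  = var b a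

-- In characteristic two the determinant is a permanent. Expanding it along the cycle through v₁ writes
-- it as a sum over the cycles C through v₁ of (product of the arcs of C) · det (M_G without C), where the
-- remaining matrix is symmetric; since the off-diagonal terms of a symmetric double sum cancel in pairs,
-- its determinant is the sum over the involutions of the remaining vertices. A vertex of K outside C
-- would be a non-fixed point of such an involution, which meets only one of its two edges, so a monomial
-- divisible by t forces C to be a K-cycle. Conversely, the monomial of a K-cycle has coefficient one: the
-- other vertices have diagonal entry 1, and the two entries set to 0 exclude the reversed cycle.

module Submission where

open import Defs
open import Algebra.Bundles using (CommutativeRing)
import Algebra.Properties.CommutativeSemigroup as CommutativeSemigroupProperties
import Algebra.Properties.Group as GroupProperties
open import Data.Bool using (Bool; true; false; _xor_; if_then_else_)
open import Data.Bool.Properties using (xor-assoc; xor-same; xor-identityʳ; xor-∧-commutativeRing)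
open import Data.Fin using (Fin; zero; suc; toℕ; fromℕ<; punchIn)
open import Data.Fin.Properties using (_≟_; toℕ-injective; toℕ-fromℕ<)
open import Data.List using (List; []; _∷_; _++_; length; tabulate; reverse)
open import Data.List.Membership.Propositional using (_∈_; _∉_)
open import Data.List.Membership.Propositional.Properties
  using (∈-++⁻; ∈-++⁺ˡ; ∈-++⁺ʳ; ∈-∃++; ∈-allFin)
open import Data.List.Properties using (unfold-reverse; length-reverse)
open import Data.List.Relation.Binary.Permutation.Propositional
  using (_↭_; prep; swap; trans; ↭-refl; ↭-sym; ↭-reflexive)
open import Data.List.Relation.Binary.Permutation.Propositional.Properties
  using (All-resp-↭; ↭-length; ∈-resp-↭; shift; ++-comm; ↭-reverse)
open import Data.List.Relation.Unary.All as All using (All; []; _∷_)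
import Data.List.Relation.Unary.All.Properties as All
open import Data.List.Relation.Unary.AllPairs using ([]; _∷_)
open import Data.List.Relation.Unary.Any using (here; there)
open import Data.List.Relation.Unary.Linked using (Linked; []; [-]; _∷_)
open import Data.List.Relation.Unary.Unique.Propositional using (Unique)
open import Data.List.Relation.Unary.Unique.Propositional.Properties using (allFin⁺)
open import Data.Maybe using (Maybe; just; nothing)
open import Data.Maybe.Properties using (just-injective)
open import Data.Nat as ℕ using (ℕ; zero; suc; _+_; _<_; _≤_; _*_; z≤n; s≤s)
open import Data.Nat.Properties
  using ( +-comm; +-assoc; +-identityʳ; +-cancelˡ-≡; +-cancelˡ-<; +-monoʳ-≤; +-commutativeSemigroup
        ; *-monoʳ-≤; *-cancelˡ-<; m≤m+n; m≤n+m; n≤1+n; m+[n∸m]≡n; m+1+n≢m; _<?_; _≤?_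
        ; ≤-refl; ≤-trans; ≤-reflexive; <-≤-trans; ≤-<-trans; <-asym; <⇒≱; <⇒≢; ≮⇒≥; ≤∧≢⇒< )
open import Data.Nat.Tactic.RingSolver using (solve-∀)
open import Data.Product using (Σ; ∃; ∃₂; _×_; _,_; proj₁; proj₂) renaming (swap to swap×)
open import Data.Sum using (_⊎_; inj₁; inj₂; [_,_]′)
open import Data.Vec as Vec using (Vec; []; _∷_; lookup; zipWith; replicate)
open import Data.Vec.Properties
  using ( ∷-injective; lookup-replicate; lookup-zipWith; lookup∘tabulate
        ; zipWith-assoc; zipWith-comm; zipWith-identityʳ )
open import Function using (_∘_; flip; id)
open import Function.Bundles using (_⇔_; mk⇔)
open import Level using (_⊔_)
open import Relation.Binary.PropositionalEquality
  using (_≡_; _≢_; _≗_; refl; sym; cong; cong₂; subst; module ≡-Reasoning)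
  renaming (trans to ≡-trans)
open import Relation.Nullary using (¬_; contradiction; does; yes; no)
open import Relation.Nullary.Decidable using (does-⇔; dec-false)

open CommutativeSemigroupProperties (CommutativeRing.+-commutativeSemigroup xor-∧-commutativeRing)
  using () renaming (interchange to xor-interchange; x∙yz≈y∙xz to xor-swap)
open CommutativeSemigroupProperties +-commutativeSemigroup
  using () renaming (interchange to +-interchange)

-- Sums in GF(2) over the ways of extracting one entry from a list

-- Permutations of the vertices never appear: rows and columns are lists, and a cycle is traced by
-- unfolding `permanent`, each chosen column naming the next row. Removing vertices yields lists
-- only up to reordering, hence the invariance of `permanent` under reordering rows and columns.
-- Both zeroed entries lie in the row or column of v₁, so the other rows and columns form a
-- symmetric matrix. They leave a single nonzero entry in the row of v₁, at v_{k+1}, and bar the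
-- direct return from there; hence C is neither a fixed point nor a 2-cycle, but a genuine cycle of
-- G. A K-cycle enters and leaves each vertex of K through different vertices, hence through both of
-- its neighbours. As the neighbours of K occupy exactly the indices k+1 to 3k, every vertex off the
-- cycle has diagonal entry 1.

private
  variable
    A B : Set
    n : ℕ

∑ : (A → List A → Bool) → List A → Bool
∑ F []       = false
∑ F (x ∷ xs) = F x xs xor ∑ (λ c cs → F c (x ∷ cs)) xs

extract-there : ∀ {c x : A} {cs xs} → c ∷ cs ↭ xs → c ∷ x ∷ cs ↭ x ∷ xs
extract-there p = trans (swap _ _ ↭-refl) (prep _ p)

-- The permutation handed to the hypothesis carries properties of all entries over to the extracted
-- entry and to the rest.
∑-cong : ∀ {F G : A → List A → Bool} xs →
  (∀ c cs → c ∷ cs ↭ xs → F c cs ≡ G c cs) → ∑ F xs ≡ ∑ G xs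
∑-cong []       F≡G = refl
∑-cong (x ∷ xs) F≡G =
  cong₂ _xor_ (F≡G x xs ↭-refl) (∑-cong xs λ c cs p → F≡G c (x ∷ cs) (extract-there p))

∑-zero : ∀ (xs : List A) → ∑ (λ _ _ → false) xs ≡ false
∑-zero []       = refl
∑-zero (x ∷ xs) = ∑-zero xs

∑-xor : ∀ (F G : A → List A → Bool) xs →
  ∑ F xs xor ∑ G xs ≡ ∑ (λ c cs → F c cs xor G c cs) xs
∑-xor F G []       = refl
∑-xor F G (x ∷ xs) = ≡-trans (xor-interchange (F x xs) _ (G x xs) _)
  (cong ((F x xs xor G x xs) xor_) (∑-xor (λ c cs → F c (x ∷ cs)) (λ c cs → G c (x ∷ cs)) xs))

∑-swap : ∀ (H : A → List A → B → List B → Bool) xs ys →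
  ∑ (λ a as → ∑ (H a as) ys) xs ≡ ∑ (λ b bs → ∑ (λ a as → H a as b bs) xs) ys
∑-swap H []       ys = sym (∑-zero ys)
∑-swap H (x ∷ xs) ys = ≡-trans (cong (∑ (H x xs) ys xor_) (∑-swap (λ a as → H a (x ∷ as)) xs ys))
  (∑-xor (H x xs) (λ b bs → ∑ (λ a as → H a (x ∷ as) b bs) xs) ys)

∑-↭ : ∀ {F : A → List A → Bool} → (∀ c {cs cs′} → cs ↭ cs′ → F c cs ≡ F c cs′) →
  ∀ {xs ys} → xs ↭ ys → ∑ F xs ≡ ∑ F ys
∑-↭ F-↭ _↭_.refl   = refl
∑-↭ F-↭ (prep x p) = cong₂ _xor_ (F-↭ x p) (∑-↭ (λ c q → F-↭ c (prep x q)) p)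
∑-↭ {F = F} F-↭ (swap {xs} {ys} x y p) = begin
  F x (y ∷ xs) xor (F y (x ∷ xs) xor ∑ (λ c cs → F c (x ∷ y ∷ cs)) xs)
    ≡⟨ xor-swap (F x (y ∷ xs)) (F y (x ∷ xs)) _ ⟩
  F y (x ∷ xs) xor (F x (y ∷ xs) xor ∑ (λ c cs → F c (x ∷ y ∷ cs)) xs)
    ≡⟨ cong₂ _xor_ (F-↭ y (prep x p)) (cong₂ _xor_ (F-↭ x (prep y p))
         (≡-trans (∑-cong xs λ c cs _ → F-↭ c (swap x y ↭-refl))
                  (∑-↭ (λ c q → F-↭ c (prep y (prep x q))) p))) ⟩
  F y (x ∷ ys) xor (F x (y ∷ ys) xor ∑ (λ c cs → F c (y ∷ x ∷ cs)) ys) ∎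
  where open ≡-Reasoning
∑-↭ F-↭ (trans p q) = ≡-trans (∑-↭ F-↭ p) (∑-↭ F-↭ q)

-- In characteristic two the off-diagonal terms of a symmetric double sum cancel in pairs.
∑-diagonal : ∀ (H : A → List A → A → List A → Bool) xs →
  (∀ {a as b bs} → a ∷ as ↭ xs → b ∷ bs ↭ xs → H a as b bs ≡ H b bs a as) →
  ∑ (λ a as → ∑ (H a as) xs) xs ≡ ∑ (λ a as → H a as a as) xs
∑-diagonal H []       H-sym = refl
∑-diagonal H (x ∷ xs) H-sym = begin
  (d xor u) xor ∑ (λ a as → H a (x ∷ as) x xs xor ∑ (λ b bs → H a (x ∷ as) b (x ∷ bs)) xs) xs
    ≡⟨ cong ((d xor u) xor_) (sym (∑-xor _ _ xs)) ⟩
  (d xor u) xor (∑ (λ a as → H a (x ∷ as) x xs) xs xor r)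
    ≡⟨ cong (λ v → (d xor u) xor (v xor r))
         (∑-cong xs λ a as p → H-sym (extract-there p) ↭-refl) ⟩
  (d xor u) xor (u xor r)
    ≡⟨ xor-assoc d u (u xor r) ⟩
  d xor (u xor (u xor r))
    ≡⟨ cong (d xor_) (≡-trans (sym (xor-assoc u u r)) (cong (_xor r) (xor-same u))) ⟩
  d xor r
    ≡⟨ cong (d xor_) (∑-diagonal (λ a as b bs → H a (x ∷ as) b (x ∷ bs)) xs
         λ p q → H-sym (extract-there p) (extract-there q)) ⟩
  d xor ∑ (λ a as → H a (x ∷ as) a (x ∷ as)) xs ∎
  where
    open ≡-Reasoning
    d = H x xs x xs
    u = ∑ (λ b bs → H x xs b (x ∷ bs)) xs
    r = ∑ (λ a as → ∑ (λ b bs → H a (x ∷ as) b (x ∷ bs)) xs) xs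

xor-true : ∀ a b → a xor b ≡ true → a ≡ true ⊎ b ≡ true
xor-true true  b     _  = inj₁ refl
xor-true false b     eq = inj₂ eq

∑-true : ∀ (F : A → List A → Bool) xs → ∑ F xs ≡ true →
  ∃₂ λ c cs → c ∷ cs ↭ xs × F c cs ≡ true
∑-true F (x ∷ xs) eq with xor-true (F x xs) _ eq
... | inj₁ Fx   = x , xs , ↭-refl , Fx
... | inj₂ rest with ∑-true (λ c cs → F c (x ∷ cs)) xs rest
...   | c , cs , p , Fc = c , x ∷ cs , extract-there p , Fc

-- Permanents of matrices of monomials over GF(2)

-- A polynomial over GF(2) is represented by the linear form f ↦ (sum of f over its monomials), and
-- a matrix entry, which is 0 or a monomial, by the operator through which multiplication by it acts.
_▹_ : Maybe (Mono n) → (Mono n → Bool) → Mono n → Bool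
(nothing ▹ f) _ = false
(just m ▹ f)  x = f (mulMono m x)

mulMono-comm : (x y : Mono n) → mulMono x y ≡ mulMono y x
mulMono-comm = zipWith-comm (zipWith-comm +-comm)

mulMono-assoc : (x y z : Mono n) → mulMono (mulMono x y) z ≡ mulMono x (mulMono y z)
mulMono-assoc = zipWith-assoc (zipWith-assoc +-assoc)

mulMono-swap : (x y z : Mono n) → mulMono x (mulMono y z) ≡ mulMono y (mulMono x z)
mulMono-swap x y z = ≡-trans (sym (mulMono-assoc x y z))
  (≡-trans (cong (λ w → mulMono w z) (mulMono-comm x y)) (mulMono-assoc y x z))

▹-cong : ∀ (d : Maybe (Mono n)) {f g} → f ≗ g → (d ▹ f) ≗ (d ▹ g)
▹-cong nothing  f≗g x = refl
▹-cong (just m) f≗g x = f≗g (mulMono m x)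

▹-swap : ∀ (d d′ : Maybe (Mono n)) f → (d ▹ (d′ ▹ f)) ≗ (d′ ▹ (d ▹ f))
▹-swap nothing  nothing   f x = refl
▹-swap nothing  (just _)  f x = refl
▹-swap (just _) nothing   f x = refl
▹-swap (just m) (just m′) f x = cong f (mulMono-swap m′ m x)

▹-true : ∀ (d : Maybe (Mono n)) {f x} → (d ▹ f) x ≡ true →
  ∃ λ m → d ≡ just m × f (mulMono m x) ≡ true
▹-true (just m) eq = m , refl , eq

-- The value of the linear form `f` on the permanent of the submatrix with rows `rs` and columns
-- `cs`. Each chosen entry is absorbed into `f`, so the base case evaluates at `oneMono`; lists of
-- unequal length give 0.
permanent : (A → B → Maybe (Mono n)) → (Mono n → Bool) → List A → List B → Bool
permanent e f []       []      = f oneMono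
permanent e f []       (_ ∷ _) = false
permanent e f (r ∷ rs) cs      = ∑ (λ c → permanent e (e r c ▹ f) rs) cs

permanent-cong : ∀ (e : A → B → Maybe (Mono n)) {f g} → f ≗ g → ∀ rs cs →
  permanent e f rs cs ≡ permanent e g rs cs
permanent-cong e f≗g []       []      = f≗g oneMono
permanent-cong e f≗g []       (_ ∷ _) = refl
permanent-cong e f≗g (r ∷ rs) cs      =
  ∑-cong cs λ c cs′ _ → permanent-cong e (▹-cong (e r c) f≗g) rs cs′

permanent-entries : ∀ {P : A → Set} {Q : B → Set} {e e′ : A → B → Maybe (Mono n)} →
  (∀ {r c} → P r → Q c → e r c ≡ e′ r c) → ∀ f {rs cs} → All P rs → All Q cs →
  permanent e f rs cs ≡ permanent e′ f rs cs
permanent-entries e≡e′ f {cs = []}    [] _ = refl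
permanent-entries e≡e′ f {cs = _ ∷ _} [] _ = refl
permanent-entries {e = e} {e′} e≡e′ f {r ∷ rs} {cs} (pr ∷ prs) qcs = ∑-cong cs λ c cs′ p →
  let qcs′ = All-resp-↭ (↭-sym p) qcs in
  ≡-trans (cong (λ d → permanent e (d ▹ f) rs cs′) (e≡e′ pr (All.head qcs′)))
          (permanent-entries e≡e′ (e′ r c ▹ f) prs (All.tail qcs′))

permanent-zero : ∀ (e : A → B → Maybe (Mono n)) {f} → (∀ x → f x ≡ false) → ∀ rs cs →
  permanent e f rs cs ≡ false
permanent-zero e f≡0 []       []      = f≡0 oneMono
permanent-zero e f≡0 []       (_ ∷ _) = refl
permanent-zero e {f} f≡0 (r ∷ rs) cs  = ≡-trans
  (∑-cong cs λ c cs′ _ → permanent-zero e (▹-zero (e r c)) rs cs′) (∑-zero cs)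
  where
    ▹-zero : ∀ d x → (d ▹ f) x ≡ false
    ▹-zero nothing  x = refl
    ▹-zero (just m) x = f≡0 (mulMono m x)

-- Induction on the rows: expand along the first row, then each minor along the column;
-- interchanging the two sums and the two multiplications gives the column expansion.
permanent-column : ∀ (e : A → B → Maybe (Mono n)) f rs c cs →
  permanent e f rs (c ∷ cs) ≡ ∑ (λ r rs′ → permanent e (e r c ▹ f) rs′ cs) rs
permanent-column e f []       c cs = refl
permanent-column e f (r ∷ rs) c cs = cong (permanent e (e r c ▹ f) rs cs xor_) (begin
  ∑ (λ c′ cs′ → permanent e (e r c′ ▹ f) rs (c ∷ cs′)) cs
    ≡⟨ ∑-cong cs (λ c′ cs′ _ → permanent-column e (e r c′ ▹ f) rs c cs′) ⟩
  ∑ (λ c′ cs′ → ∑ (λ r′ rs′ → permanent e (e r′ c ▹ (e r c′ ▹ f)) rs′ cs′) rs) cs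
    ≡⟨ ∑-swap (λ c′ cs′ r′ rs′ → permanent e (e r′ c ▹ (e r c′ ▹ f)) rs′ cs′) cs rs ⟩
  ∑ (λ r′ rs′ → ∑ (λ c′ cs′ → permanent e (e r′ c ▹ (e r c′ ▹ f)) rs′ cs′) cs) rs
    ≡⟨ ∑-cong rs (λ r′ rs′ _ → ∑-cong cs λ c′ cs′ _ →
         permanent-cong e (▹-swap (e r′ c) (e r c′) f) rs′ cs′) ⟩
  ∑ (λ r′ rs′ → permanent e (e r′ c ▹ f) (r ∷ rs′) cs) rs ∎)
  where open ≡-Reasoning

permanent-transpose : ∀ (e : A → B → Maybe (Mono n)) f rs cs →
  permanent e f rs cs ≡ permanent (flip e) f cs rs
permanent-transpose e f []       []       = refl
permanent-transpose e f (_ ∷ _)  []       = refl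
permanent-transpose e f rs       (c ∷ cs) = ≡-trans (permanent-column e f rs c cs)
  (∑-cong rs λ r rs′ _ → permanent-transpose e (e r c ▹ f) rs′ cs)

permanent-columns-↭ : ∀ (e : A → B → Maybe (Mono n)) f rs {cs cs′} → cs ↭ cs′ →
  permanent e f rs cs ≡ permanent e f rs cs′
permanent-columns-↭ e f []       {[]}    {[]}    p = refl
permanent-columns-↭ e f []       {_ ∷ _} {_ ∷ _} p = refl
permanent-columns-↭ e f []       {_ ∷ _} {[]}    p = contradiction (↭-length p) λ ()
permanent-columns-↭ e f []       {[]}    {_ ∷ _} p = contradiction (↭-length p) λ ()
permanent-columns-↭ e f (r ∷ rs) p = ∑-↭ (λ c → permanent-columns-↭ e (e r c ▹ f) rs) p

permanent-rows-↭ : ∀ (e : A → B → Maybe (Mono n)) f {rs rs′} cs → rs ↭ rs′ →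
  permanent e f rs cs ≡ permanent e f rs′ cs
permanent-rows-↭ e f {rs} {rs′} cs p = ≡-trans (permanent-transpose e f rs cs)
  (≡-trans (permanent-columns-↭ (flip e) f cs p) (sym (permanent-transpose e f rs′ cs)))

-- What must vanish is the action on `f`, not the entry itself: an entry may be nonzero and still
-- not divide the monomial whose coefficient `f` reads.
permanent-first : ∀ (e : A → B → Maybe (Mono n)) f r rs c {cs} →
  All (λ c′ → ∀ x → (e r c′ ▹ f) x ≡ false) cs →
  permanent e f (r ∷ rs) (c ∷ cs) ≡ permanent e (e r c ▹ f) rs cs
permanent-first e f r rs c {cs} zeros = ≡-trans (cong (permanent e (e r c ▹ f) rs cs xor_)
  (≡-trans (∑-cong cs λ c′ cs′ p →
              permanent-zero e (All.head (All-resp-↭ (↭-sym p) zeros)) rs (c ∷ cs′))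
           (∑-zero cs)))
  (xor-identityʳ _)

-- Expanding a permanent along the cycle through a vertex

-- A pair contributes the entries in both of its positions, hence the square of `x`. The partner of
-- `a` may stand anywhere in the list, which the permutation accounts for.
data Involution (e : A → A → Maybe (Mono n)) : List A → Mono n → Set where
  []   : Involution e [] oneMono
  loop : ∀ {a as x y} → e a a ≡ just x → Involution e as y → Involution e (a ∷ as) (mulMono x y)
  pair : ∀ {a b as bs x y} → e a b ≡ just x → b ∷ bs ↭ as → Involution e bs y →
    Involution e (a ∷ as) (mulMono x (mulMono x y))

data Route (e : A → A → Maybe (Mono n)) (w : A) : A → List A → Mono n → Set where
  close : ∀ {u x} → e u w ≡ just x → Route e w u [] x
  step  : ∀ {u v vs x y} → e u v ≡ just x → Route e w v vs y → Route e w u (v ∷ vs) (mulMono x y)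

module _ (e : A → A → Maybe (Mono n)) {P : A → Set}
         (e-sym : ∀ {a b} → P a → P b → e a b ≡ e b a) where

  permanent-symmetric : ∀ f {rs cs} → All P rs → All P cs →
    permanent e f rs cs ≡ permanent e f cs rs
  permanent-symmetric f {rs} {cs} prs pcs = ≡-trans (permanent-transpose e f rs cs)
    (permanent-entries {e = flip e} {e} (λ pr pc → e-sym pc pr) f pcs prs)

  -- Row `s` takes column `v`, and column `s` is taken by row `r`. Transposing the remaining minor
  -- exchanges the roles of `r` and `v`; this is the symmetry that `∑-diagonal` asks for.
  permanent-minor-swap : ∀ f s {v vs r rs ss} → P s → All P ss → v ∷ vs ↭ ss → r ∷ rs ↭ ss →
    permanent e (e r s ▹ (e s v ▹ f)) rs vs ≡ permanent e (e v s ▹ (e s r ▹ f)) vs rs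
  permanent-minor-swap f s {v} {vs} {r} {rs} ps pss p q
    with pv ∷ pvs ← All-resp-↭ (↭-sym p) pss
    with pr ∷ prs ← All-resp-↭ (↭-sym q) pss = begin
      permanent e (e r s ▹ (e s v ▹ f)) rs vs
        ≡⟨ permanent-symmetric (e r s ▹ (e s v ▹ f)) prs pvs ⟩
      permanent e (e r s ▹ (e s v ▹ f)) vs rs
        ≡⟨ permanent-cong e (▹-swap (e r s) (e s v) f) vs rs ⟩
      permanent e (e s v ▹ (e r s ▹ f)) vs rs
        ≡⟨ cong₂ (λ d d′ → permanent e (d ▹ (d′ ▹ f)) vs rs) (e-sym ps pv) (e-sym pr ps) ⟩
      permanent e (e v s ▹ (e s r ▹ f)) vs rs ∎
    where open ≡-Reasoning

  -- The bound `l` drives the recursion, because the list left after removing a pair is known only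
  -- through a permutation and is no structural subterm.
  involution-of-permanent : ∀ l f ss → length ss ≤ l → All P ss →
    permanent e f ss ss ≡ true → ∃ λ y → Involution e ss y × f y ≡ true
  involution-of-permanent l f [] _ _ eq = oneMono , [] , eq
  involution-of-permanent (suc l) f (s ∷ ss) (s≤s len) (ps ∷ pss) eq
    with xor-true (permanent e (e s s ▹ f) ss ss) _ eq
  ... | inj₁ fixed
    with y , inv , fy ← involution-of-permanent l (e s s ▹ f) ss len pss fixed
    with x , ess , fxy ← ▹-true (e s s) fy = mulMono x y , loop ess inv , fxy
  ... | inj₂ moved
    -- Expanding along row and column `s` gives a double sum over `v` and `r`; only the terms with
    -- `r` equal to `v` survive, and these transpose `s` and `v`.
    with v , vs , p , pv ← ∑-true _ ss (≡-trans (sym (≡-trans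
           (∑-cong ss λ v vs _ → permanent-column e (e s v ▹ f) ss s vs)
           (∑-diagonal (λ v vs r rs → permanent e (e r s ▹ (e s v ▹ f)) rs vs) ss
             (permanent-minor-swap f s ps pss)))) moved)
    with pv′ ∷ pvs ← All-resp-↭ (↭-sym p) pss
    with y , inv , fy ← involution-of-permanent l (e v s ▹ (e s v ▹ f)) vs
           (≤-trans (n≤1+n _) (≤-trans (≤-reflexive (↭-length p)) len)) pvs pv
    with x , evs , fxy ← ▹-true (e v s) fy
    with x′ , esv , fxxy ← ▹-true (e s v) fxy
    -- By symmetry the entries at `(v, s)` and `(s, v)` are the same monomial, which therefore
    -- appears squared.
    with refl ← just-injective (≡-trans (sym evs) (≡-trans (e-sym pv′ ps) esv)) =
      mulMono x (mulMono x y) , pair esv p inv , fxxy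

  -- Rows and columns differ only in `u` against `w`. Either row `u` takes column `w`, which leaves
  -- `ss` on both sides, or it takes some `v`, and the rest differs only in `v` against `w`.
  -- Symmetry is asked on `ss` alone, so `u` and `w` may carry the zeroed entries.
  route-of-permanent : ∀ l f u w ss → length ss ≤ l → All P ss →
    permanent e f (u ∷ ss) (w ∷ ss) ≡ true →
    ∃₂ λ vs rs → ∃₂ λ x y →
      vs ++ rs ↭ ss × Route e w u vs x × Involution e rs y × f (mulMono x y) ≡ true
  route-of-permanent l f u w ss len pss eq with xor-true (permanent e (e u w ▹ f) ss ss) _ eq
  ... | inj₁ closed
    with y , inv , fy ← involution-of-permanent l (e u w ▹ f) ss len pss closed
    with x , euw , fxy ← ▹-true (e u w) fy =
      [] , ss , x , y , ↭-refl , close euw , inv , fxy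
  route-of-permanent l f u w ss len pss eq | inj₂ open′
    with v , vs , p , pv ← ∑-true _ ss open′
    with l | ≤-trans (≤-reflexive (↭-length p)) len
  ... | suc l | s≤s len′
    with _ ∷ pvs ← All-resp-↭ (↭-sym p) pss
    with ws , rs , x , y , q , route , inv , fxy ←
           route-of-permanent l (e u v ▹ f) v w vs len′ pvs
             (≡-trans (permanent-rows-↭ e (e u v ▹ f) (w ∷ vs) p) pv)
    with z , euv , fzxy ← ▹-true (e u v) fxy =
      v ∷ ws , rs , mulMono z x , y , trans (prep v q) p , step euv route , inv ,
      ≡-trans (cong f (mulMono-assoc z x y)) fzxy

-- The determinant modulo two is a permanent

⨁ : ∀ m → (Fin m → Bool) → Bool
⨁ zero    G = false
⨁ (suc m) G = G zero xor ⨁ m (G ∘ suc)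

⨁-cong : ∀ m {G G′ : Fin m → Bool} → G ≗ G′ → ⨁ m G ≡ ⨁ m G′
⨁-cong zero    G≗G′ = refl
⨁-cong (suc m) G≗G′ = cong₂ _xor_ (G≗G′ zero) (⨁-cong m (G≗G′ ∘ suc))

-- The columns kept by `punchIn j` are, in order, those that remain after extracting entry `j`; this
-- matches the minors of `det` with the recursion of `permanent`.
∑-tabulate : ∀ {r} (F : A → List A → Bool) (γ : Fin (suc r) → A) →
  ∑ F (tabulate γ) ≡ ⨁ (suc r) (λ j → F (γ j) (tabulate (γ ∘ punchIn j)))
∑-tabulate {r = zero}  F γ = refl
∑-tabulate {r = suc r} F γ = cong (F (γ zero) (tabulate (γ ∘ suc)) xor_)
  (∑-tabulate (λ c cs → F c (γ zero ∷ cs)) (γ ∘ suc))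

indicator : Mono n → Mono n → Bool
indicator m x = does (x ≟ₘ m)

module _ {c ℓ} (F : Field c ℓ) where
  open Field F using (Carrier; _≈_; 1#; 0#)
  open Polynomials F
  private module R = Field F

  monoSum : (Mono n → Bool) → Poly n → Bool
  monoSum f []            = false
  monoSum f ((_ , m) ∷ p) = f m xor monoSum f p

  monoSum-++ : ∀ (f : Mono n → Bool) p q → monoSum f (p ++ q) ≡ monoSum f p xor monoSum f q
  monoSum-++ f []            q = refl
  monoSum-++ f ((_ , m) ∷ p) q =
    ≡-trans (cong (f m xor_) (monoSum-++ f p q)) (sym (xor-assoc (f m) _ _))

  monoSum-neg : ∀ (f : Mono n → Bool) p → monoSum f (-ₚ p) ≡ monoSum f p
  monoSum-neg f []            = refl
  monoSum-neg f ((_ , m) ∷ p) = cong (f m xor_) (monoSum-neg f p)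

  monoSum-zero : ∀ (p : Poly n) → monoSum (λ _ → false) p ≡ false
  monoSum-zero []      = refl
  monoSum-zero (_ ∷ p) = monoSum-zero p

  data Represents {n} : Maybe (Mono n) → Poly n → Set (c ⊔ ℓ) where
    none : Represents nothing []
    one  : ∀ {a m} → a ≈ 1# → Represents (just m) ((a , m) ∷ [])

  monoSum-* : ∀ (f : Mono n → Bool) {d p} → Represents d p → ∀ q →
    monoSum f (p *ₚ q) ≡ monoSum (d ▹ f) q
  monoSum-* f none    q              = sym (monoSum-zero q)
  monoSum-* f (one _) []             = refl
  monoSum-* f (one {m = m} a≈1) ((_ , x) ∷ q) =
    cong (f (mulMono m x) xor_) (monoSum-* f (one a≈1) q)

  term : ∀ {r} → (Fin (suc r) → Fin (suc r) → Poly n) → Fin (suc r) → Poly n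
  term M j = M zero j *ₚ det (λ a b → M (suc a) (punchIn j b))

  -- The loop over the columns inside det has no name outside of its definition. It is recovered by
  -- unification: abstracting captured over the column map, the sign and the size makes its arguments
  -- distinct variables, and comparing both sides then solves laplace.
  mutual
    laplace : ∀ {r} → (Fin (suc r) → Fin (suc r) → Poly n) →
      (m : ℕ) → (Fin m → Fin (suc r)) → Bool → Poly n
    laplace = _

    captured : ∀ {r} (M : Fin (suc (suc r)) → Fin (suc (suc r)) → Poly n) →
      det M ≡ term M zero ++ ((-ₚ term M (suc zero)) ++ laplace M r (λ x → suc (suc x)) true)
    captured {r = r} M
      with term M zero | -ₚ term M (suc zero) | (λ (x : Fin r) → Fin.suc (Fin.suc x)) | true
    ... | t₀ | t₁ | col | s with suc r
    ... | w = refl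

  monoSum-laplace : ∀ {r} (f : Mono n → Bool) (M : Fin (suc r) → Fin (suc r) → Poly n) m col s →
    monoSum f (laplace M m col s) ≡ ⨁ m (λ x → monoSum f (term M (col x)))
  monoSum-laplace f M zero    col s     = refl
  monoSum-laplace f M (suc m) col true  = ≡-trans (monoSum-++ f (term M (col zero)) _)
    (cong (monoSum f (term M (col zero)) xor_) (monoSum-laplace f M m (col ∘ suc) false))
  monoSum-laplace f M (suc m) col false = ≡-trans (monoSum-++ f (-ₚ term M (col zero)) _)
    (cong₂ _xor_ (monoSum-neg f (term M (col zero))) (monoSum-laplace f M m (col ∘ suc) true))

  -- The labellings `ρ` and `γ` let the hypothesis pass to minors, where only the labels change.
  monoSum-det : ∀ {r} (M : Fin r → Fin r → Poly n)
    (e : A → B → Maybe (Mono n)) (ρ : Fin r → A) (γ : Fin r → B) →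
    (∀ a b → Represents (e (ρ a) (γ b)) (M a b)) →
    ∀ f → monoSum f (det M) ≡ permanent e f (tabulate ρ) (tabulate γ)
  monoSum-det {r = zero}  M e ρ γ M-rep f = xor-identityʳ (f oneMono)
  monoSum-det {r = suc r} M e ρ γ M-rep f = begin
    monoSum f (det M)
      ≡⟨ monoSum-laplace f M (suc r) id true ⟩
    ⨁ (suc r) (λ j → monoSum f (term M j))
      ≡⟨ ⨁-cong (suc r) (λ j → ≡-trans (monoSum-* f (M-rep zero j) (det (λ a b → M (suc a) (punchIn j b))))
           (monoSum-det _ e (ρ ∘ suc) (γ ∘ punchIn j) (λ a b → M-rep (suc a) (punchIn j b))
             (e (ρ zero) (γ j) ▹ f))) ⟩
    ⨁ (suc r) (λ j → permanent e (e (ρ zero) (γ j) ▹ f) (tabulate (ρ ∘ suc)) (tabulate (γ ∘ punchIn j)))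
      ≡⟨ sym (∑-tabulate (λ c → permanent e (e (ρ zero) c ▹ f) (tabulate (ρ ∘ suc))) γ) ⟩
    permanent e f (tabulate ρ) (tabulate γ) ∎
    where open ≡-Reasoning

  module _ (1+1≈0 : HasCharTwo F) where

    Units : Poly n → Set (c ⊔ ℓ)
    Units p = All (λ (a , _) → a ≈ 1#) p

    -1≈1 : R.- 1# ≈ 1#
    -1≈1 = R.sym (GroupProperties.inverseʳ-unique R.+-group 1# 1# 1+1≈0)

    Units-neg : ∀ {p : Poly n} → Units p → Units (-ₚ p)
    Units-neg []         = []
    Units-neg (a≈1 ∷ us) = R.trans (R.-‿cong a≈1) -1≈1 ∷ Units-neg us

    Units-* : ∀ {p q : Poly n} → Units p → Units q → Units (p *ₚ q)
    Units-* []         vs = []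
    Units-* (a≈1 ∷ us) vs = All.++⁺
      (All.map⁺ (All.map (λ b≈1 → R.trans (R.*-cong a≈1 b≈1) (R.*-identityˡ 1#)) vs))
      (Units-* us vs)

    mutual
      Units-laplace : ∀ {r} {M : Fin (suc r) → Fin (suc r) → Poly n} → (∀ a b → Units (M a b)) →
        ∀ m col s → Units (laplace M m col s)
      Units-laplace us zero    col s     = []
      Units-laplace us (suc m) col true  =
        All.++⁺ (Units-term us (col zero)) (Units-laplace us m (col ∘ suc) false)
      Units-laplace us (suc m) col false =
        All.++⁺ (Units-neg (Units-term us (col zero))) (Units-laplace us m (col ∘ suc) true)

      Units-term : ∀ {r} {M : Fin (suc r) → Fin (suc r) → Poly n} → (∀ a b → Units (M a b)) →
        ∀ j → Units (term M j)
      Units-term us j = Units-* (us zero j) (Units-det λ a b → us (suc a) (punchIn j b))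

      Units-det : ∀ {r} {M : Fin r → Fin r → Poly n} → (∀ a b → Units (M a b)) → Units (det M)
      Units-det {r = zero}  us = R.refl ∷ []
      Units-det {r = suc r} us = Units-laplace us (suc r) id true

    embed : Bool → Carrier
    embed b = if b then 1# else 0#

    embed-true-xor : ∀ b → 1# R.+ embed b ≈ embed (true xor b)
    embed-true-xor true  = 1+1≈0
    embed-true-xor false = R.+-identityʳ 1#

    coeff-units : ∀ m {p : Poly n} → Units p → coeff m p ≈ embed (monoSum (indicator m) p)
    coeff-units m []                       = R.refl
    coeff-units m {(a , x) ∷ p} (a≈1 ∷ us) with x ≟ₘ m
    ... | yes _ = R.trans (R.+-cong a≈1 (coeff-units m us)) (embed-true-xor _)
    ... | no _  = R.trans (R.+-identityˡ _) (coeff-units m us)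

    coeff-det : ∀ m (M : Fin n → Fin n → Poly n) (e : Fin n → Fin n → Maybe (Mono n)) →
      (∀ a b → Represents (e a b) (M a b)) →
      coeff m (det M) ≈ embed (permanent e (indicator m) (tabulate id) (tabulate id))
    coeff-det m M e M-rep = R.trans (coeff-units m (Units-det λ a b → units (M-rep a b)))
      (R.reflexive (cong embed (monoSum-det M e id id M-rep (indicator m))))
      where
        units : ∀ {d p} → Represents d p → Units p
        units none      = []
        units (one a≈1) = a≈1 ∷ []

-- Exponents of monomials

zipWith-cancelˡ : ∀ {f : A → B → B} → (∀ x {y z} → f x y ≡ f x z → y ≡ z) →
  ∀ (xs : Vec A n) {ys zs} → zipWith f xs ys ≡ zipWith f xs zs → ys ≡ zs
zipWith-cancelˡ cancel []       {[]}     {[]}     eq = refl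
zipWith-cancelˡ cancel (x ∷ xs) {y ∷ ys} {z ∷ zs} eq with ∷-injective eq
... | eq₁ , eq₂ = cong₂ _∷_ (cancel x eq₁) (zipWith-cancelˡ cancel xs eq₂)

mulMono-cancelˡ : ∀ (x : Mono n) {y z} → mulMono x y ≡ mulMono x z → y ≡ z
mulMono-cancelˡ = zipWith-cancelˡ (zipWith-cancelˡ λ a → +-cancelˡ-≡ a _ _)

mulMono-identityʳ : (x : Mono n) → mulMono x oneMono ≡ x
mulMono-identityʳ = zipWith-identityʳ (zipWith-identityʳ +-identityʳ)

indicator-self : (m : Mono n) → indicator m m ≡ true
indicator-self m with m ≟ₘ m
... | yes _  = refl
... | no m≢m = contradiction refl m≢m

indicator-true : ∀ {m x : Mono n} → indicator m x ≡ true → x ≡ m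
indicator-true {m = m} {x} eq with x ≟ₘ m
... | yes x≡m = x≡m

▹-indicator : ∀ (x y : Mono n) → (just x ▹ indicator (mulMono x y)) ≗ indicator y
▹-indicator x y q = does-⇔ (mk⇔ (mulMono-cancelˡ x) (cong (mulMono x)))
  (mulMono x q ≟ₘ mulMono x y) (q ≟ₘ y)

▹-indicator-self : ∀ (x : Mono n) → (just x ▹ indicator x) ≗ indicator oneMono
▹-indicator-self x q = ≡-trans (cong (λ m → indicator m (mulMono x q)) (sym (mulMono-identityʳ x)))
  (▹-indicator x oneMono q)

exponent : Mono n → Fin n → Fin n → ℕ
exponent x p q = lookup (lookup x p) q

exponent-mul : ∀ (x y : Mono n) p q → exponent (mulMono x y) p q ≡ exponent x p q + exponent y p q
exponent-mul x y p q = ≡-trans (cong (λ v → lookup v q) (lookup-zipWith _ p x y))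
  (lookup-zipWith _ q (lookup x p) (lookup y p))

exponent-one : ∀ (p q : Fin n) → exponent oneMono p q ≡ 0
exponent-one {n} p q = ≡-trans (cong (λ v → lookup v q) (lookup-replicate p (replicate n 0)))
  (lookup-replicate q 0)

exponent-tabulate : ∀ (x : Mono n) {h : Fin n → Fin n → ℕ} →
  x ≡ (Vec.tabulate λ a → Vec.tabulate (h a)) → ∀ p q → exponent x p q ≡ h p q
exponent-tabulate _ {h} refl p q = ≡-trans
  (cong (λ v → lookup v q) (lookup∘tabulate (λ a → Vec.tabulate (h a)) p)) (lookup∘tabulate (h p) q)

exponent-var : ∀ (i j : Fin n) → exponent (varMono i j) i j ≡ 1
exponent-var i j rewrite exponent-tabulate (varMono i j) refl i j with i ≟ i | j ≟ j
... | yes _  | yes _  = refl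
... | no i≢i | _      = contradiction refl i≢i
... | yes _  | no j≢j = contradiction refl j≢j

exponent-var-support : ∀ (i j p q : Fin n) → 0 < exponent (varMono i j) p q → p ≡ i × q ≡ j
exponent-var-support i j p q pos
  with p ≟ i | q ≟ j | subst (0 <_) (exponent-tabulate (varMono i j) refl p q) pos
... | yes p≡i | yes q≡j | _ = p≡i , q≡j
... | yes _   | no _    | ()
... | no _    | _       | ()

-- The exponents of x_{pq} and x_{qp} added together: only one of these two indeterminates is ever
-- used, and the sum spares the distinction.
degree : Mono n → Fin n → Fin n → ℕ
degree x p q = exponent x p q + exponent x q p

degree-mul : ∀ (x y : Mono n) p q → degree (mulMono x y) p q ≡ degree x p q + degree y p q
degree-mul x y p q = ≡-trans (cong₂ _+_ (exponent-mul x y p q) (exponent-mul x y q p))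
  (+-interchange (exponent x p q) _ _ _)

+-positive : ∀ a {b} → 0 < a + b → 0 < a ⊎ 0 < b
+-positive zero    pos = inj₂ pos
+-positive (suc a) pos = inj₁ (s≤s z≤n)

degree-mul-positive : ∀ (x y : Mono n) {p q} → 0 < degree (mulMono x y) p q →
  0 < degree x p q ⊎ 0 < degree y p q
degree-mul-positive x y {p} {q} pos =
  +-positive (degree x p q) (subst (0 <_) (degree-mul x y p q) pos)

degree-one : ∀ (p q : Fin n) → ¬ 0 < degree oneMono p q
degree-one p q pos with degree oneMono p q | cong₂ _+_ (exponent-one p q) (exponent-one q p)
degree-one p q ()  | _ | refl

edge : Fin n → Fin n → Mono n
edge a b with toℕ a <? toℕ b
... | yes _ = varMono a b
... | no _  = varMono b a

edge-< : ∀ {a b : Fin n} → toℕ a < toℕ b → edge a b ≡ varMono a b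
edge-< {a = a} {b} a<b with toℕ a <? toℕ b
... | yes _  = refl
... | no a≮b = contradiction a<b a≮b

edge-≥ : ∀ {a b : Fin n} → ¬ toℕ a < toℕ b → edge a b ≡ varMono b a
edge-≥ {a = a} {b} a≮b with toℕ a <? toℕ b
... | yes a<b = contradiction a<b a≮b
... | no _    = refl

edge-sym : ∀ {a b : Fin n} → a ≢ b → edge a b ≡ edge b a
edge-sym {a = a} {b} a≢b with toℕ a <? toℕ b
... | yes a<b = sym (edge-≥ (<-asym a<b))
... | no a≮b  = sym (edge-< (≤∧≢⇒< (≮⇒≥ a≮b) λ eq → a≢b (sym (toℕ-injective eq))))

edge-support : ∀ (a b : Fin n) {p q} → 0 < degree (edge a b) p q →
  (p ≡ a × q ≡ b) ⊎ (p ≡ b × q ≡ a)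
edge-support a b {p} {q} pos with toℕ a <? toℕ b
... | yes _ with +-positive (exponent (varMono a b) p q) pos
...   | inj₁ pos′ = inj₁ (exponent-var-support a b p q pos′)
...   | inj₂ pos′ = inj₂ (swap× (exponent-var-support a b q p pos′))
edge-support a b {p} {q} pos | no _ with +-positive (exponent (varMono b a) p q) pos
...   | inj₁ pos′ = inj₂ (exponent-var-support b a p q pos′)
...   | inj₂ pos′ = inj₁ (swap× (exponent-var-support b a q p pos′))

edge-degree : ∀ (a b : Fin n) → 0 < degree (edge a b) a b
edge-degree a b with toℕ a <? toℕ b
... | yes _  = ≤-trans (≤-reflexive (sym (exponent-var a b))) (m≤m+n _ _)
... | no _ = ≤-trans (≤-reflexive (sym (exponent-var b a))) (m≤n+m _ _)

module _ {n : ℕ} (k : ℕ) where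

  KNeighbour : Fin n → Fin n → Set
  KNeighbour u v = toℕ v ≡ k + 2 * toℕ u ⊎ toℕ v ≡ k + 2 * toℕ u + 1

  tMono-exponent : ∀ u v → toℕ u < k → KNeighbour u v → exponent (tMono n k) u v ≡ 1
  tMono-exponent u v u<k nb rewrite exponent-tabulate (tMono n k) refl u v
    with toℕ u <? k | toℕ v ℕ.≟ k + 2 * toℕ u | toℕ v ℕ.≟ k + 2 * toℕ u + 1
  ... | yes _  | yes _  | _      = refl
  ... | yes _  | no _   | yes _  = refl
  ... | yes _  | no ¬p  | no ¬q  = contradiction nb [ ¬p , ¬q ]′
  ... | no u≮k | _      | _      = contradiction u<k u≮k

  tMono-support : ∀ u v →
    exponent (tMono n k) u v ≡ 0 ⊎ (toℕ u < k × KNeighbour u v × exponent (tMono n k) u v ≡ 1)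
  tMono-support u v rewrite exponent-tabulate (tMono n k) refl u v
    with toℕ u <? k | toℕ v ℕ.≟ k + 2 * toℕ u | toℕ v ℕ.≟ k + 2 * toℕ u + 1
  ... | yes u<k | yes p | _     = inj₂ (u<k , inj₁ p , refl)
  ... | yes u<k | no _  | yes q = inj₂ (u<k , inj₂ q , refl)
  ... | yes _   | no _  | no _  = inj₁ refl
  ... | no _    | _     | _     = inj₁ refl

-- The entries of M_G

module _ {n : ℕ} (G : SimpleGraph n) (k : ℕ) where
  open SimpleGraph G using (Adj; adj?) renaming (sym to Adj-sym)

  Cut : Fin n → Fin n → Set
  Cut a b = (toℕ a ≡ 0 × toℕ b ≡ k + 1) ⊎ (toℕ a ≡ k × toℕ b ≡ 0)

  Arc : Fin n → Fin n → Set
  Arc a b = a ≢ b × ¬ Cut a b × Adj a b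

  -- A specification by three exclusive cases, free of the order of tests in `MG`;
  -- `Entry-functional` turns it into equations between entries.
  data Entry (a b : Fin n) : Maybe (Mono n) → Set where
    loop  : a ≡ b → 3 * k ≤ toℕ a → Entry a b (just oneMono)
    arc   : Arc a b → Entry a b (just (edge a b))
    empty : ¬ (a ≡ b × 3 * k ≤ toℕ a) → ¬ Arc a b → Entry a b nothing

  Entry-functional : ∀ {a b d d′} → Entry a b d → Entry a b d′ → d ≡ d′
  Entry-functional (loop _ _)    (loop _ _)    = refl
  Entry-functional (loop p _)    (arc (q , _)) = contradiction p q
  Entry-functional (loop p q)    (empty r _)   = contradiction (p , q) r
  Entry-functional (arc (q , _)) (loop p _)    = contradiction p q
  Entry-functional (arc _)       (arc _)       = refl
  Entry-functional (arc p)       (empty _ r)   = contradiction p r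
  Entry-functional (empty r _)   (loop p q)    = contradiction (p , q) r
  Entry-functional (empty _ r)   (arc p)       = contradiction p r
  Entry-functional (empty _ _)   (empty _ _)   = refl

  -- Both cut positions lie in row 0 or column 0, so away from vertex 0 no arc loses its reverse.
  Arc-sym : ∀ {a b} → toℕ a ≢ 0 → toℕ b ≢ 0 → Arc a b → Arc b a
  Arc-sym a≢0 b≢0 (a≢b , _ , adj) =
    a≢b ∘ sym , [ b≢0 ∘ proj₁ , a≢0 ∘ proj₂ ]′ , Adj-sym adj

  Entry-sym : ∀ {a b d} → toℕ a ≢ 0 → toℕ b ≢ 0 → Entry a b d → Entry b a d
  Entry-sym a≢0 b≢0 (loop refl p)   = loop refl p
  Entry-sym a≢0 b≢0 (arc α)         =
    subst (λ m → Entry _ _ (just m)) (sym (edge-sym (proj₁ α))) (arc (Arc-sym a≢0 b≢0 α))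
  Entry-sym a≢0 b≢0 (empty ¬p ¬q) =
    empty (λ { (refl , p) → ¬p (refl , p) }) (¬q ∘ Arc-sym b≢0 a≢0)

  cut-entry : ∀ {a b} → a ≢ b → Cut a b → Entry a b nothing
  cut-entry a≢b cut = empty (a≢b ∘ proj₁) (λ α → proj₁ (proj₂ α) cut)

  forward-entry : ∀ {a b} → Arc a b → toℕ a < toℕ b → Entry a b (just (varMono a b))
  forward-entry α a<b = subst (λ m → Entry _ _ (just m)) (edge-< a<b) (arc α)

  backward-entry : ∀ {a b} → Arc a b → ¬ toℕ a < toℕ b → Entry a b (just (varMono b a))
  backward-entry α a≮b = subst (λ m → Entry _ _ (just m)) (edge-≥ a≮b) (arc α)

  module _ {c ℓ} (F : Field c ℓ) where
    open Field F using (1#) renaming (refl to ≈-refl)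

    -- The entry computes only once the tests made by `MG` are decided, hence the repeated branches
    -- for the four ways in which neither cut applies.
    MG-entry : ∀ a b → ∃ λ d → Entry a b d × Represents F d (MG F G k a b)
    MG-entry a b with a ≟ b
    MG-entry a b | yes a≡b with 3 * k ≤? toℕ a
    ... | yes p = just oneMono , loop a≡b p , one ≈-refl
    ... | no ¬p = nothing , empty (¬p ∘ proj₂) (λ α → proj₁ α a≡b) , none
    MG-entry a b | no a≢b
      with toℕ a ℕ.≟ 0 | toℕ b ℕ.≟ k + 1 | toℕ a ℕ.≟ k | toℕ b ℕ.≟ 0
    ... | yes p | yes q | _     | _     = _ , cut-entry a≢b (inj₁ (p , q)) , none
    ... | no _  | _     | yes p | yes q = _ , cut-entry a≢b (inj₂ (p , q)) , none
    ... | yes _ | no _  | yes p | yes q = _ , cut-entry a≢b (inj₂ (p , q)) , none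
    MG-entry a b | no a≢b | no ¬p | _     | no ¬q | _      with adj? a b
    ... | no ¬adj = _ , empty (a≢b ∘ proj₁) (¬adj ∘ proj₂ ∘ proj₂) , none
    ... | yes adj with toℕ a <? toℕ b
    ...   | yes a<b = _ , forward-entry (a≢b , [ ¬p ∘ proj₁ , ¬q ∘ proj₁ ]′ , adj) a<b , one ≈-refl
    ...   | no a≮b  = _ , backward-entry (a≢b , [ ¬p ∘ proj₁ , ¬q ∘ proj₁ ]′ , adj) a≮b , one ≈-refl
    MG-entry a b | no a≢b | no ¬p | _     | yes _ | no ¬q  with adj? a b
    ... | no ¬adj = _ , empty (a≢b ∘ proj₁) (¬adj ∘ proj₂ ∘ proj₂) , none
    ... | yes adj with toℕ a <? toℕ b
    ...   | yes a<b = _ , forward-entry (a≢b , [ ¬p ∘ proj₁ , ¬q ∘ proj₂ ]′ , adj) a<b , one ≈-refl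
    ...   | no a≮b  = _ , backward-entry (a≢b , [ ¬p ∘ proj₁ , ¬q ∘ proj₂ ]′ , adj) a≮b , one ≈-refl
    MG-entry a b | no a≢b | yes _ | no ¬p | no ¬q | _      with adj? a b
    ... | no ¬adj = _ , empty (a≢b ∘ proj₁) (¬adj ∘ proj₂ ∘ proj₂) , none
    ... | yes adj with toℕ a <? toℕ b
    ...   | yes a<b = _ , forward-entry (a≢b , [ ¬p ∘ proj₂ , ¬q ∘ proj₁ ]′ , adj) a<b , one ≈-refl
    ...   | no a≮b  = _ , backward-entry (a≢b , [ ¬p ∘ proj₂ , ¬q ∘ proj₁ ]′ , adj) a≮b , one ≈-refl
    MG-entry a b | no a≢b | yes _ | no ¬p | yes _ | no ¬q  with adj? a b
    ... | no ¬adj = _ , empty (a≢b ∘ proj₁) (¬adj ∘ proj₂ ∘ proj₂) , none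
    ... | yes adj with toℕ a <? toℕ b
    ...   | yes a<b = _ , forward-entry (a≢b , [ ¬p ∘ proj₂ , ¬q ∘ proj₂ ]′ , adj) a<b , one ≈-refl
    ...   | no a≮b  = _ , backward-entry (a≢b , [ ¬p ∘ proj₂ , ¬q ∘ proj₂ ]′ , adj) a≮b , one ≈-refl

-- Divisibility, lists of distinct elements, and paths

∣ₘ-mulˡ : ∀ (x y : Mono n) → x ∣ₘ mulMono x y
∣ₘ-mulˡ x y p q = ≤-trans (m≤m+n _ _) (≤-reflexive (sym (exponent-mul x y p q)))

∣ₘ-mulʳ : ∀ (x y z : Mono n) → z ∣ₘ y → z ∣ₘ mulMono x y
∣ₘ-mulʳ x y z z∣y p q =
  ≤-trans (≤-trans (z∣y p q) (m≤n+m _ _)) (≤-reflexive (sym (exponent-mul x y p q)))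

Unique-resp-↭ : ∀ {xs ys : List A} → xs ↭ ys → Unique xs → Unique ys
Unique-resp-↭ _↭_.refl     u                     = u
Unique-resp-↭ (prep x p)   (x∉ ∷ u)              = All-resp-↭ p x∉ ∷ Unique-resp-↭ p u
Unique-resp-↭ (swap x y p) ((x≢y ∷ x∉) ∷ y∉ ∷ u) =
  ((x≢y ∘ sym) ∷ All-resp-↭ p y∉) ∷ All-resp-↭ p x∉ ∷ Unique-resp-↭ p u
Unique-resp-↭ (trans p q)  u                     = Unique-resp-↭ q (Unique-resp-↭ p u)

Unique-++⁻ˡ : ∀ (xs : List A) {ys} → Unique (xs ++ ys) → Unique xs
Unique-++⁻ˡ []       u        = []
Unique-++⁻ˡ (x ∷ xs) (x∉ ∷ u) = All.++⁻ˡ xs x∉ ∷ Unique-++⁻ˡ xs u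

Unique-++⁻ʳ : ∀ (xs : List A) {ys} → Unique (xs ++ ys) → Unique ys
Unique-++⁻ʳ []       u       = u
Unique-++⁻ʳ (x ∷ xs) (_ ∷ u) = Unique-++⁻ʳ xs u

Unique-++-disjoint : ∀ (xs : List A) {ys v} → Unique (xs ++ ys) → v ∈ xs → v ∉ ys
Unique-++-disjoint (x ∷ xs) (x∉ ∷ u) (here refl) v∈ys = All.lookup x∉ (∈-++⁺ʳ xs v∈ys) refl
Unique-++-disjoint (x ∷ xs) (_ ∷ u)  (there v∈)  v∈ys = Unique-++-disjoint xs u v∈ v∈ys

∈-tail : ∀ {x y : A} {xs} → y ≢ x → y ∈ x ∷ xs → y ∈ xs
∈-tail y≢x (here y≡x) = contradiction y≡x y≢x
∈-tail y≢x (there y∈) = y∈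

complement : ∀ {xs : List A} ys → Unique xs → (∀ {x} → x ∈ xs → x ∈ ys) → ∃ λ rs → xs ++ rs ↭ ys
complement ys []                sub = ys , ↭-refl
complement {xs = x ∷ _} ys (x∉ ∷ u) sub with ∈-∃++ (sub (here refl))
... | as , bs , refl with complement (as ++ bs) u (λ y∈ →
        ∈-tail (All.lookup x∉ y∈ ∘ sym) (∈-resp-↭ (shift x as bs) (sub (there y∈))))
...   | rs , p = rs , trans (prep x p) (↭-sym (shift x as bs))

-- Both ends and the last arc belong to the datum, so a cycle is a `Path` from a vertex to itself,
-- and rotating it is splitting and concatenating.
data Path {A : Set} (R : A → A → Set) : A → List A → A → Set where
  close : ∀ {u w} → R u w → Path R u [] w
  step  : ∀ {u v vs w} → R u v → Path R v vs w → Path R u (v ∷ vs) w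

module _ {R : A → A → Set} where

  Linked⇒Path : ∀ {u w} vs → Linked R (u ∷ vs) → R (lastOf u vs) w → Path R u vs w
  Linked⇒Path []       _         last = close last
  Linked⇒Path (v ∷ vs) (uRv ∷ l) last = step uRv (Linked⇒Path vs l last)

  Path-++ : ∀ {u vs w ws z} → Path R u vs w → Path R w ws z → Path R u (vs ++ w ∷ ws) z
  Path-++ (close uRw)   q = step uRw q
  Path-++ (step uRv p) q = step uRv (Path-++ p q)

  Path-split : ∀ {u v w} vs {ws} → Path R u (vs ++ v ∷ ws) w → Path R u vs v × Path R v ws w
  Path-split []       (step uRv p) = close uRv , p
  Path-split (_ ∷ vs) (step uRv p) with Path-split vs p
  ... | q , r = step uRv q , r

  Path-reverse : (∀ {a b} → R a b → R b a) →
    ∀ {u w} vs → Path R u vs w → Path R w (reverse vs) u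
  Path-reverse R-sym []       (close uRw)  = close (R-sym uRw)
  Path-reverse R-sym (v ∷ vs) (step uRv p) = subst (λ zs → Path R _ zs _)
    (sym (unfold-reverse v vs)) (Path-++ (Path-reverse R-sym vs p) (close (R-sym uRv)))

halve : ∀ d → ∃ λ i → d ≡ 2 * i ⊎ d ≡ 2 * i + 1
halve zero    = 0 , inj₁ refl
halve (suc d) with halve d
... | i , inj₁ d≡ = i , inj₂ (≡-trans (cong suc d≡) (+-comm 1 (2 * i)))
... | i , inj₂ d≡ = suc i , inj₁ (≡-trans (cong suc d≡) (rearrange i))
  where
    rearrange : ∀ i → suc (2 * i + 1) ≡ 2 * suc i
    rearrange = solve-∀

-- Monomials of routes and involutions in M_G

module _ {N : ℕ} (G : SimpleGraph (suc N)) (k : ℕ)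
         (e : Fin (suc N) → Fin (suc N) → Maybe (Mono (suc N)))
         (e-entry : ∀ a b → Entry G k a b (e a b)) where
  open SimpleGraph G using (Adj; irrefl) renaming (sym to Adj-sym)

  V : Set
  V = Fin (suc N)

  e-sym : ∀ {a b} → a ≢ zero → b ≢ zero → e a b ≡ e b a
  e-sym {a} {b} a≢0 b≢0 = Entry-functional G k
    (Entry-sym G k (a≢0 ∘ toℕ-injective) (b≢0 ∘ toℕ-injective) (e-entry a b)) (e-entry b a)

  e-loop : ∀ {a} → 3 * k ≤ toℕ a → e a a ≡ just oneMono
  e-loop {a} p = Entry-functional G k (e-entry a a) (loop refl p)

  e-arc : ∀ {a b} → Arc G k a b → e a b ≡ just (edge a b)
  e-arc {a} {b} α = Entry-functional G k (e-entry a b) (arc α)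

  e-just : ∀ {a b z} → e a b ≡ just z →
    (a ≡ b × 3 * k ≤ toℕ a × z ≡ oneMono) ⊎ (Arc G k a b × z ≡ edge a b)
  e-just {a} {b} eq with e a b | e-entry a b
  e-just refl | _ | loop p q = inj₁ (p , q , refl)
  e-just refl | _ | arc α    = inj₂ (α , refl)

  e-just-≢ : ∀ {a b z} → a ≢ b → e a b ≡ just z → Arc G k a b × z ≡ edge a b
  e-just-≢ a≢b eq with e-just eq
  ... | inj₁ (a≡b , _) = contradiction a≡b a≢b
  ... | inj₂ α         = α

  e-support : ∀ {a b z p q} → e a b ≡ just z → 0 < degree z p q →
    (p ≡ a × q ≡ b) ⊎ (p ≡ b × q ≡ a)
  e-support {p = p} {q} eq pos with e-just eq
  ... | inj₁ (_ , _ , refl) = contradiction pos (degree-one p q)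
  ... | inj₂ (_ , refl)     = edge-support _ _ pos

  route-support : ∀ {w u vs x p q} → Route e w u vs x → 0 < degree x p q → p ∈ u ∷ vs ⊎ p ≡ w
  route-support (close eq) pos with e-support eq pos
  ... | inj₁ (p≡u , _) = inj₁ (here p≡u)
  ... | inj₂ (p≡w , _) = inj₂ p≡w
  route-support (step {x = x} {y} eq route) pos with degree-mul-positive x y pos
  ... | inj₁ pos′ with e-support eq pos′
  ...   | inj₁ (p≡u , _) = inj₁ (here p≡u)
  ...   | inj₂ (p≡v , _) = inj₁ (there (here p≡v))
  route-support (step {x = x} {y} eq route) pos | inj₂ pos′ with route-support route pos′
  ...   | inj₁ p∈  = inj₁ (there p∈)
  ...   | inj₂ p≡w = inj₂ p≡w

  pair-support : ∀ {a b x y p q} → e a b ≡ just x → 0 < degree (mulMono x (mulMono x y)) p q →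
    (p ≡ a × q ≡ b) ⊎ (p ≡ b × q ≡ a) ⊎ 0 < degree y p q
  pair-support {x = x} {y} eq pos with degree-mul-positive x (mulMono x y) pos
  ... | inj₁ pos′ = [ inj₁ , inj₂ ∘ inj₁ ]′ (e-support eq pos′)
  ... | inj₂ pos′ with degree-mul-positive x y pos′
  ...   | inj₁ pos″ = [ inj₁ , inj₂ ∘ inj₁ ]′ (e-support eq pos″)
  ...   | inj₂ pos″ = inj₂ (inj₂ pos″)

  involution-support : ∀ {ss y p q} → Involution e ss y → 0 < degree y p q → p ∈ ss
  involution-support {p = p} {q} [] pos = contradiction pos (degree-one p q)
  involution-support (loop {x = x} {y} eq inv) pos with degree-mul-positive x y pos
  ... | inj₁ pos′ = here ([ proj₁ , proj₁ ]′ (e-support eq pos′))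
  ... | inj₂ pos′ = there (involution-support inv pos′)
  involution-support (pair eq perm inv) pos with pair-support eq pos
  ... | inj₁ (p≡a , _)        = here p≡a
  ... | inj₂ (inj₁ (p≡b , _)) = there (∈-resp-↭ perm (here p≡b))
  ... | inj₂ (inj₂ pos′)      = there (∈-resp-↭ perm (there (involution-support inv pos′)))

  -- A fixed point has index at least 3k, so `u` lies in a pair and `v` is its partner. As the
  -- vertices are distinct, no other pair has an edge at `u`, and fixed points contribute the
  -- monomial 1.
  involution-partner : ∀ {ss y u} → Involution e ss y → Unique ss → toℕ u < 3 * k → u ∈ ss →
    ∃ λ v → ∀ {q} → 0 < degree y u q → q ≡ v
  involution-partner {u = u} (loop {x = x} {y} eq inv) (a∉ ∷ uniq) u< u∈ with e-just eq
  ... | inj₂ ((a≢a , _) , _) = contradiction refl a≢a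
  ... | inj₁ (_ , 3k≤a , refl) with u∈
  ...   | here refl  = contradiction 3k≤a (<⇒≱ u<)
  ...   | there u∈′ with involution-partner inv uniq u< u∈′
  ...     | v , only = v , λ {q} pos →
            [ (λ pos′ → contradiction pos′ (degree-one u q)) , only ]′ (degree-mul-positive x y pos)
  involution-partner {u = u} (pair {a} {b} {x = x} {y} eq perm inv) (a∉ ∷ uniq) u< u∈
    with Unique-resp-↭ (↭-sym perm) uniq | All-resp-↭ (↭-sym perm) a∉ | u∈
  ... | b∉ ∷ _ | a≢b ∷ a∉bs | here refl = b , only
    where
      only : ∀ {q} → 0 < degree (mulMono x (mulMono x y)) u q → q ≡ b
      only pos with pair-support eq pos
      ... | inj₁ (_ , q≡b)          = q≡b
      ... | inj₂ (inj₁ (a≡b , _))   = contradiction a≡b a≢b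
      ... | inj₂ (inj₂ pos′)        =
        contradiction refl (All.lookup a∉bs (involution-support inv pos′))
  ... | b∉ ∷ uniq′ | a≢b ∷ a∉bs | there u∈as with ∈-resp-↭ (↭-sym perm) u∈as
  ...   | here refl = a , only
    where
      only : ∀ {q} → 0 < degree (mulMono x (mulMono x y)) u q → q ≡ a
      only pos with pair-support eq pos
      ... | inj₁ (b≡a , _)          = contradiction (sym b≡a) a≢b
      ... | inj₂ (inj₁ (_ , q≡a))   = q≡a
      ... | inj₂ (inj₂ pos′)        =
        contradiction refl (All.lookup b∉ (involution-support inv pos′))
  ...   | there u∈bs with involution-partner inv uniq′ u< u∈bs
  ...     | v , only = v , only′
    where
      only′ : ∀ {q} → 0 < degree (mulMono x (mulMono x y)) u q → q ≡ v
      only′ pos with pair-support eq pos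
      ... | inj₁ (u≡a , _)          = contradiction (sym u≡a) (All.lookup a∉bs u∈bs)
      ... | inj₂ (inj₁ (u≡b , _))   = contradiction (sym u≡b) (All.lookup b∉ u∈bs)
      ... | inj₂ (inj₂ pos′)        = only pos′

  -- Distinctness, together with `u ≢ w`, keeps diagonal entries out, so every entry met is an edge
  -- of `G`.
  route-path : ∀ {w u vs x} → Route e w u vs x → u ≢ w → w ∉ vs → Unique (u ∷ vs) →
    Linked Adj (u ∷ vs) × Adj (lastOf u vs) w
  route-path (close eq) u≢w _ _ = [-] , proj₂ (proj₂ (proj₁ (e-just-≢ u≢w eq)))
  route-path (step eq route) u≢w w∉ ((u≢v ∷ _) ∷ uniq)
    with route-path route (λ v≡w → w∉ (here (sym v≡w))) (w∉ ∘ there) uniq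
  ... | linked , closing = proj₂ (proj₂ (proj₁ (e-just-≢ u≢v eq))) ∷ linked , closing

  module _ (0<k : 0 < k) (3k≤ : 3 * k ≤ suc N) (nbhd : KNeighbourhoods G k) where

    k≤3k : k ≤ 3 * k
    k≤3k = m≤m+n k (2 * k)

    -- The entries at v₁, and the K-cycle behind a monomial divisible by t

    start-neighbour : ∀ {v} → Adj zero v → toℕ v ≡ k ⊎ toℕ v ≡ k + 1
    start-neighbour {v} adj with proj₁ (nbhd zero v 0<k) adj
    ... | inj₁ eq = inj₁ (≡-trans eq (+-identityʳ k))
    ... | inj₂ eq = inj₂ (≡-trans eq (cong (_+ 1) (+-identityʳ k)))

    start-arc : ∀ {v} → Arc G k zero v → toℕ v ≡ k
    start-arc (_ , ¬cut , adj) with start-neighbour adj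
    ... | inj₁ v≡k   = v≡k
    ... | inj₂ v≡k+1 = contradiction (inj₁ (refl , v≡k+1)) ¬cut

    -- Vertex 0 has the neighbours k and k+1; the entry at k+1 is cut, and the diagonal entry
    -- vanishes because 0 < 3k.
    e-start : ∀ {v x} → e zero v ≡ just x → toℕ v ≡ k
    e-start eq with e-just eq
    ... | inj₁ (_ , 3k≤0 , _) = contradiction (≤-trans 0<k (≤-trans k≤3k 3k≤0)) λ ()
    ... | inj₂ (α , _)        = start-arc α

    e-end : ∀ {v x} → v ≢ zero → e v zero ≡ just x → toℕ v ≢ k
    e-end v≢0 eq v≡k with e-just-≢ v≢0 eq
    ... | (_ , ¬cut , _) , _ = ¬cut (inj₂ (v≡k , refl))

    neighbour-bound : ∀ {u} → u < k → suc (k + 2 * u + 1) ≤ 3 * k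
    -- `3 * k` computes to `k + 2 * k`, so it suffices to bound `2 * suc u` by `2 * k`.
    neighbour-bound {u} u<k = ≤-trans (≤-reflexive (rearrange k u)) (+-monoʳ-≤ k (*-monoʳ-≤ 2 u<k))
      where
        rearrange : ∀ k u → suc (k + 2 * u + 1) ≡ k + 2 * suc u
        rearrange = solve-∀

    first-neighbour : ∀ {u : V} → toℕ u < k → ∃ λ (v : V) → toℕ v ≡ k + 2 * toℕ u
    first-neighbour u<k = fromℕ< bound , toℕ-fromℕ< bound
      where bound = ≤-trans (s≤s (m≤m+n _ 1)) (≤-trans (neighbour-bound u<k) 3k≤)

    second-neighbour : ∀ {u : V} → toℕ u < k → ∃ λ (v : V) → toℕ v ≡ k + 2 * toℕ u + 1
    second-neighbour u<k = fromℕ< bound , toℕ-fromℕ< bound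
      where bound = ≤-trans (neighbour-bound u<k) 3k≤

    -- An involution meets the edges at a given vertex in at most one edge, whereas t demands two.
    not-in-involution : ∀ {vs rs x y u} → zero ∉ rs → Unique (vs ++ rs) →
      Route e zero zero vs x → Involution e rs y → tMono (suc N) k ∣ₘ mulMono x y →
      toℕ u < k → u ∉ rs
    not-in-involution {vs} {rs} {x} {y} {u} 0∉ uniq route inv t∣ u<k u∈rs
      with involution-partner inv (Unique-++⁻ʳ vs uniq) (<-≤-trans u<k k≤3k) u∈rs
         | first-neighbour u<k | second-neighbour u<k
    -- Both neighbours of `u` would equal its partner `v`, whereas their indices differ by one.
    ... | v , only | a , a≡ | b , b≡ = m+1+n≢m _ (≡-trans (sym b≡)
            (≡-trans (cong toℕ (≡-trans (only (uses b (inj₂ b≡))) (sym (only (uses a (inj₁ a≡)))))) a≡))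
      where
        uses : ∀ q → KNeighbour k u q → 0 < degree y u q
        uses q nb with degree-mul-positive x y {u} {q} (≤-trans (≤-reflexive
                         (sym (tMono-exponent k u q u<k nb))) (≤-trans (t∣ u q) (m≤m+n _ _)))
        ... | inj₂ pos = pos
        ... | inj₁ pos with route-support route pos
        ...   | inj₁ (here refl)  = contradiction u∈rs 0∉
        ...   | inj₁ (there u∈vs) = contradiction u∈rs (Unique-++-disjoint vs uniq u∈vs)
        ...   | inj₂ refl         = contradiction u∈rs 0∉

    -- Short routes have to be refuted: there is no diagonal entry at 0, and a 2-cycle through 0 and
    -- k would return through the cut position `(k, 0)`.
    cycle-of-route : ∀ {vs x} → Route e zero zero vs x → Unique (zero ∷ vs) →
      (∀ (u : V) → toℕ u < k → u ∈ zero ∷ vs) → KCycle G k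
    cycle-of-route (close eq) _ _ = contradiction (e-start eq) (<⇒≢ 0<k)
    cycle-of-route (step eq (close eq′)) ((0≢v ∷ _) ∷ _) _ =
      contradiction (e-start eq) (e-end (0≢v ∘ sym) eq′)
    cycle-of-route (step {v = v} eq route@(step {v = v′} {vs} _ _)) ((0≢v ∷ 0∉) ∷ uniq) covers
      with linked , closing ← route-path route (0≢v ∘ sym) (λ 0∈ → All.lookup 0∉ 0∈ refl) uniq =
        record
          { first    = zero
          ; rest     = v ∷ v′ ∷ vs
          ; long     = s≤s (s≤s z≤n)
          ; distinct = (0≢v ∷ 0∉) ∷ uniq
          ; path     = proj₂ (proj₂ (proj₁ (e-just-≢ 0≢v eq))) ∷ linked
          ; closing  = closing
          } , covers

    cycle-of-permanent : ∀ {m} → tMono (suc N) k ∣ₘ m →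
      permanent e (indicator m) (tabulate id) (tabulate id) ≡ true → KCycle G k
    cycle-of-permanent {m} t∣m eq
      with vs , rs , x , y , perm , route , inv , hit ←
             route-of-permanent e e-sym _ (indicator m) zero zero (tabulate suc) ≤-refl
               (All.tabulate⁺ λ _ ()) eq
      with refl ← indicator-true {x = mulMono x y} hit
      with 0∉ ∷ uniq ← Unique-resp-↭ (prep zero (↭-sym perm)) (allFin⁺ (suc N)) =
        cycle-of-route route (Unique-++⁻ˡ (zero ∷ vs) (0∉ ∷ uniq)) covers
      where
        covers : ∀ u → toℕ u < k → u ∈ zero ∷ vs
        covers zero    _ = here refl
        covers (suc u) u<k with ∈-++⁻ vs (∈-tail (λ ()) (∈-resp-↭ (prep zero (↭-sym perm)) (∈-allFin (suc u))))
        ... | inj₁ u∈vs = there u∈vs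
        ... | inj₂ u∈rs = contradiction u∈rs
          (not-in-involution (λ 0∈ → All.lookup 0∉ (∈-++⁺ʳ vs 0∈) refl) uniq route inv t∣m u<k)

    -- The coefficient of the monomial of a closed route

    ▹-nothing : ∀ {a b f} → (∀ {z} → e a b ≢ just z) → ∀ x → (e a b ▹ f) x ≡ false
    ▹-nothing {a} {b} absent x with e a b
    ... | nothing = refl
    ... | just _  = contradiction refl absent

    ▹-avoid : ∀ {a b m} → a ≢ b → ¬ 0 < degree m a b → ∀ x → (e a b ▹ indicator m) x ≡ false
    ▹-avoid {a} {b} {m} a≢b unused x with e a b in eq
    ... | nothing = refl
    ... | just z  with e-just-≢ a≢b eq
    ...   | _ , refl = dec-false (mulMono z x ≟ₘ m) λ { refl → unused
            (≤-trans (edge-degree a b) (≤-trans (m≤m+n _ _) (≤-reflexive (sym (degree-mul z x a b))))) }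

    -- Only the identity contributes to the coefficient of the monomial 1: an off-diagonal entry is
    -- absent or an indeterminate, which does not divide 1.
    loops-permanent : ∀ {rs} → All (λ r → 3 * k ≤ toℕ r) rs → Unique rs →
      permanent e (indicator oneMono) rs rs ≡ true
    loops-permanent []       []          = indicator-self (oneMono {suc N})
    loops-permanent {r ∷ rs} (3k≤r ∷ all) (r∉ ∷ uniq) = begin
      permanent e (indicator oneMono) (r ∷ rs) (r ∷ rs)
        ≡⟨ permanent-first e (indicator oneMono) r rs r
             (All.map (λ r≢c → ▹-avoid r≢c (degree-one r _)) r∉) ⟩
      permanent e (e r r ▹ indicator oneMono) rs rs
        ≡⟨ cong (λ d → permanent e (d ▹ indicator oneMono) rs rs) (e-loop 3k≤r) ⟩
      permanent e (just oneMono ▹ indicator oneMono) rs rs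
        ≡⟨ permanent-cong e (▹-indicator-self oneMono) rs rs ⟩
      permanent e (indicator oneMono) rs rs
        ≡⟨ loops-permanent all uniq ⟩
      true ∎
      where open ≡-Reasoning

    -- The end `w` stays in front of the columns, to be taken by the last row of the route; the swap
    -- only brings the successor `v` forward for one expansion.
    step-permanent : ∀ y rs {u v w x cs} → e u v ≡ just x →
      All (λ c → ∀ q → (e u c ▹ indicator (mulMono x y)) q ≡ false) (w ∷ cs) →
      permanent e (indicator (mulMono x y)) (u ∷ rs) (w ∷ v ∷ cs) ≡
      permanent e (indicator y) rs (w ∷ cs)
    step-permanent y rs {u} {v} {w} {x} {cs} eq avoid = begin
      permanent e (indicator (mulMono x y)) (u ∷ rs) (w ∷ v ∷ cs)
        ≡⟨ permanent-columns-↭ e (indicator (mulMono x y)) (u ∷ rs) (swap w v ↭-refl) ⟩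
      permanent e (indicator (mulMono x y)) (u ∷ rs) (v ∷ w ∷ cs)
        ≡⟨ permanent-first e (indicator (mulMono x y)) u rs v avoid ⟩
      permanent e (e u v ▹ indicator (mulMono x y)) rs (w ∷ cs)
        ≡⟨ cong (λ d → permanent e (d ▹ indicator (mulMono x y)) rs (w ∷ cs)) eq ⟩
      permanent e (just x ▹ indicator (mulMono x y)) rs (w ∷ cs)
        ≡⟨ permanent-cong e (▹-indicator x y) rs (w ∷ cs) ⟩
      permanent e (indicator y) rs (w ∷ cs) ∎
      where open ≡-Reasoning

    -- In the row of a vertex of the route, every column but that of its successor contributes an
    -- edge foreign to the route, so that each expansion has a single nonzero term.
    route-permanent : ∀ {u vs x rs} → Route e zero u vs x → Unique (u ∷ vs ++ rs) →
      u ≢ zero → zero ∉ vs ++ rs → All (λ r → 3 * k ≤ toℕ r) rs →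
      permanent e (indicator x) (u ∷ vs ++ rs) (zero ∷ vs ++ rs) ≡ true
    route-permanent {u} {rs = rs} (close {x = x} eq) (u∉ ∷ uniq) u≢0 0∉ loops = begin
      permanent e (indicator x) (u ∷ rs) (zero ∷ rs)
        ≡⟨ permanent-first e (indicator x) u rs zero (All.tabulate λ {c} c∈ →
             ▹-avoid (All.lookup u∉ c∈) λ pos → [ (λ { (_ , refl) → 0∉ c∈ }) ,
               (λ { (u≡0 , _) → u≢0 u≡0 }) ]′ (e-support eq pos)) ⟩
      permanent e (e u zero ▹ indicator x) rs rs
        ≡⟨ cong (λ d → permanent e (d ▹ indicator x) rs rs) eq ⟩
      permanent e (just x ▹ indicator x) rs rs
        ≡⟨ permanent-cong e (▹-indicator-self x) rs rs ⟩
      permanent e (indicator oneMono) rs rs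
        ≡⟨ loops-permanent loops uniq ⟩
      true ∎
      where open ≡-Reasoning
    route-permanent {u} {rs = rs} (step {v = v} {vs} {x} {y} eq route)
                    (u∉ ∷ uniq@(v∉ ∷ _)) u≢0 0∉ loops =
      ≡-trans (step-permanent y (v ∷ vs ++ rs) eq (avoid u≢0 (0∉ ∘ here) ∷ All.tabulate λ c∈ →
                avoid (All.lookup u∉ (there c∈)) (All.lookup v∉ c∈ ∘ sym)))
              (route-permanent route uniq (0∉ ∘ here ∘ sym) (0∉ ∘ there) loops)
      where
        avoid : ∀ {c} → u ≢ c → c ≢ v → ∀ q → (e u c ▹ indicator (mulMono x y)) q ≡ false
        avoid {c} u≢c c≢v = ▹-avoid u≢c unused
          where
            unused : ¬ 0 < degree (mulMono x y) u c
            unused pos with degree-mul-positive x y pos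
            ... | inj₁ pos′ = [ c≢v ∘ proj₂ , All.head u∉ ∘ proj₁ ]′ (e-support eq pos′)
            ... | inj₂ pos′ with route-support route pos′
            ...   | inj₂ u≡0 = u≢0 u≡0
            ...   | inj₁ u∈  = All.lookup u∉ (∈-++⁺ˡ u∈) refl

    -- The edge between 0 and the last vertex of the route divides the monomial, so in row 0 the
    -- divisibility argument of `route-permanent` fails. The cut takes its place: row 0 has a single
    -- nonzero entry.
    start-permanent : ∀ {v vs x y rs} → e zero v ≡ just x → Route e zero v vs y →
      Unique (zero ∷ v ∷ vs ++ rs) → All (λ r → 3 * k ≤ toℕ r) rs →
      permanent e (indicator (mulMono x y)) (zero ∷ v ∷ vs ++ rs) (zero ∷ v ∷ vs ++ rs) ≡ true
    start-permanent {v} {vs} {y = y} {rs} eq route (0∉ ∷ uniq@(v∉ ∷ _)) loops =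
      ≡-trans (step-permanent y (v ∷ vs ++ rs) eq (avoid (All.head 0∉) ∷ All.tabulate λ c∈ →
                avoid (All.lookup v∉ c∈ ∘ sym)))
              (route-permanent route uniq (All.head 0∉ ∘ sym) (λ 0∈ → All.lookup 0∉ (there 0∈) refl) loops)
      where
        avoid : ∀ {c f} → c ≢ v → ∀ q → (e zero c ▹ f) q ≡ false
        avoid c≢v = ▹-nothing λ eq′ →
          c≢v (toℕ-injective (≡-trans (e-start eq′) (sym (e-start eq))))

    -- Both edges at a vertex of K lie on a closed route through it

    record Crosses (a b : V) (x : Mono (suc N)) : Set where
      constructor crosses
      field
        {monomial} : Mono (suc N)
        entry      : e a b ≡ just monomial
        divides    : monomial ∣ₘ x

    crosses-head : ∀ {a b x y} → e a b ≡ just x → Crosses a b (mulMono x y)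
    crosses-head {x = x} {y} eq = crosses eq (∣ₘ-mulˡ x y)

    crosses-tail : ∀ {a b x y} → Crosses a b y → Crosses a b (mulMono x y)
    crosses-tail {x = x} {y} (crosses {z} eq z∣y) = crosses eq (∣ₘ-mulʳ x y z z∣y)

    route-last : ∀ {w u vs x} → Route e w u vs x → ∃ λ a → a ∈ u ∷ vs × Crosses a w x
    route-last (close eq) = _ , here refl , crosses eq λ _ _ → ≤-refl
    route-last (step eq route) with route-last route
    ... | a , a∈ , cross = a , there a∈ , crosses-tail cross

    -- Predecessor and successor of `p` could coincide only if the route is closed and `p` is its
    -- one inner vertex, which the alternative in the hypothesis excludes.
    route-through : ∀ {w u vs x p} → Route e w u vs x → u ≢ w ⊎ 2 ≤ length vs → w ∉ vs →
      Unique (u ∷ vs) → p ∈ vs →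
      ∃₂ λ a b → a ≢ b × a ∈ w ∷ u ∷ vs × b ∈ w ∷ u ∷ vs × Crosses a p x × Crosses p b x
    route-through (step eq (close eq′)) (inj₁ u≢w) _ _ (here refl) =
      _ , _ , u≢w , there (here refl) , here refl ,
      crosses-head eq , crosses-tail (crosses eq′ λ _ _ → ≤-refl)
    route-through (step eq (close eq′)) (inj₂ (s≤s ())) _ _ (here refl)
    route-through (step eq (step eq′ _)) _ _ ((_ ∷ u≢ ∷ _) ∷ _) (here refl) =
      _ , _ , u≢ , there (here refl) , there (there (there (here refl))) ,
      crosses-head eq , crosses-tail (crosses-head eq′)
    route-through {w} {u} (step {v = v} {vs} eq route) _ w∉ (_ ∷ uniq) (there p∈)
      with a , b , a≢b , a∈ , b∈ , crossₐ , cross_b ←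
             route-through route (inj₁ λ v≡w → w∉ (here (sym v≡w))) (w∉ ∘ there) uniq p∈ =
        a , b , a≢b , widen a∈ , widen b∈ , crosses-tail crossₐ , crosses-tail cross_b
      where
        widen : ∀ {c} → c ∈ w ∷ v ∷ vs → c ∈ w ∷ u ∷ v ∷ vs
        widen (here c≡w) = here c≡w
        widen (there c∈) = there (there c∈)

    closed-route-through : ∀ {w v v′ vs x p} → Route e w w (v ∷ v′ ∷ vs) x →
      Unique (w ∷ v ∷ v′ ∷ vs) → p ∈ w ∷ v ∷ v′ ∷ vs →
      ∃₂ λ a b → a ≢ b × a ∈ w ∷ v ∷ v′ ∷ vs × b ∈ w ∷ v ∷ v′ ∷ vs × Crosses a p x × Crosses p b x
    closed-route-through (step eq (step eq′ route)) (_ ∷ v∉ ∷ _) (here refl)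
      with a , a∈ , cross ← route-last route =
        a , _ , (λ a≡v → All.lookup v∉ a∈ (sym a≡v)) , there (there a∈) , there (here refl) ,
        crosses-tail (crosses-tail cross) , crosses-head eq
    closed-route-through {w} {v} {v′} {vs} route uniq@(w∉ ∷ _) (there p∈)
      with a , b , a≢b , a∈ , b∈ , crossₐ , cross_b ←
             route-through route (inj₂ (s≤s (s≤s z≤n))) (λ w∈ → All.lookup w∉ w∈ refl) uniq p∈ =
        a , b , a≢b , narrow a∈ , narrow b∈ , crossₐ , cross_b
      where
        narrow : ∀ {c} → c ∈ w ∷ w ∷ v ∷ v′ ∷ vs → c ∈ w ∷ v ∷ v′ ∷ vs
        narrow (here c≡w) = here c≡w
        narrow (there c∈) = c∈

    arc-before : ∀ {a u x} → toℕ u < k → Crosses a u x → Adj a u × edge u a ∣ₘ x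
    arc-before {x = x} u<k (crosses eq z∣x) with e-just eq
    ... | inj₁ (refl , 3k≤u , _)        = contradiction (≤-trans k≤3k 3k≤u) (<⇒≱ u<k)
    ... | inj₂ ((a≢u , _ , adj) , refl) = adj , subst (_∣ₘ x) (edge-sym a≢u) z∣x

    arc-after : ∀ {u b x} → toℕ u < k → Crosses u b x → Adj u b × edge u b ∣ₘ x
    arc-after u<k (crosses eq z∣x) with e-just eq
    ... | inj₁ (_ , 3k≤u , _)         = contradiction (≤-trans k≤3k 3k≤u) (<⇒≱ u<k)
    ... | inj₂ ((_ , _ , adj) , refl) = adj , z∣x

    KNeighbour-≥ : ∀ (u v : V) → KNeighbour k u v → k ≤ toℕ v
    KNeighbour-≥ u v (inj₁ eq) = ≤-trans (m≤m+n k _) (≤-reflexive (sym eq))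
    KNeighbour-≥ u v (inj₂ eq) = ≤-trans (≤-trans (m≤m+n k _) (m≤m+n _ 1)) (≤-reflexive (sym eq))

    edge-exponent : ∀ (u v : V) x → toℕ u < k → KNeighbour k u v → edge u v ∣ₘ x → 1 ≤ exponent x u v
    edge-exponent u v x u<k nb edge∣x = ≤-trans (≤-reflexive (sym (≡-trans
      (cong (λ z → exponent z u v) (edge-< (<-≤-trans u<k (KNeighbour-≥ u v nb)))) (exponent-var u v))))
      (edge∣x u v)

    KNeighbour-pigeonhole : ∀ (u : V) {a b q} → a ≢ b → KNeighbour k u a → KNeighbour k u b →
      KNeighbour k u q → q ≡ a ⊎ q ≡ b
    KNeighbour-pigeonhole u a≢b (inj₁ a≡) (inj₁ b≡) _ = contradiction (toℕ-injective (≡-trans a≡ (sym b≡))) a≢b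
    KNeighbour-pigeonhole u a≢b (inj₂ a≡) (inj₂ b≡) _ = contradiction (toℕ-injective (≡-trans a≡ (sym b≡))) a≢b
    KNeighbour-pigeonhole u _ (inj₁ a≡) (inj₂ b≡) (inj₁ q≡) = inj₁ (toℕ-injective (≡-trans q≡ (sym a≡)))
    KNeighbour-pigeonhole u _ (inj₁ a≡) (inj₂ b≡) (inj₂ q≡) = inj₂ (toℕ-injective (≡-trans q≡ (sym b≡)))
    KNeighbour-pigeonhole u _ (inj₂ a≡) (inj₁ b≡) (inj₁ q≡) = inj₂ (toℕ-injective (≡-trans q≡ (sym b≡)))
    KNeighbour-pigeonhole u _ (inj₂ a≡) (inj₁ b≡) (inj₂ q≡) = inj₁ (toℕ-injective (≡-trans q≡ (sym a≡)))

    -- The closed route passes through `u` from one neighbour to a different one, and `u` has only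
    -- two. This serves twice: t divides the monomial, and every vertex of index below 3k lies on
    -- the route.
    neighbour-on-route : ∀ {v v′ vs x u q} → Route e zero zero (v ∷ v′ ∷ vs) x →
      Unique (zero ∷ v ∷ v′ ∷ vs) → u ∈ zero ∷ v ∷ v′ ∷ vs → toℕ u < k → KNeighbour k u q →
      q ∈ zero ∷ v ∷ v′ ∷ vs × 1 ≤ exponent x u q
    neighbour-on-route {x = x} {u} {q} route uniq u∈ u<k nb
      with a , b , a≢b , a∈ , b∈ , crossₐ , cross_b ← closed-route-through route uniq u∈
      with αₐ , divₐ ← arc-before u<k crossₐ | α_b , div_b ← arc-after u<k cross_b
      with KNeighbour-pigeonhole u a≢b (proj₁ (nbhd u a u<k) (Adj-sym αₐ)) (proj₁ (nbhd u b u<k) α_b) nb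
    ... | inj₁ refl = a∈ , edge-exponent u q x u<k nb divₐ
    ... | inj₂ refl = b∈ , edge-exponent u q x u<k nb div_b

    -- From a K-cycle to a closed route and its coefficient

    rotate-to-start : (C : Cycle G) → zero ∈ Cycle.vertices C →
      ∃ λ vs → Path Adj zero vs zero × zero ∷ vs ↭ Cycle.vertices C
    rotate-to-start C 0∈ with Linked⇒Path (Cycle.rest C) (Cycle.path C) (Cycle.closing C) | 0∈
    ... | path | here refl = Cycle.rest C , path , ↭-refl
    ... | path | there 0∈rest with xs , ys , eq ← ∈-∃++ 0∈rest
      with p , q ← Path-split xs (subst (λ zs → Path Adj _ zs _) eq path) =
        ys ++ Cycle.first C ∷ xs , Path-++ q p ,
        trans (++-comm (zero ∷ ys) (Cycle.first C ∷ xs)) (↭-reflexive (cong (Cycle.first C ∷_) (sym eq)))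

    -- Of a closed path and its reversal, exactly one leaves the start along the arc that is not cut.
    orient : ∀ {v v′ vs} → Path Adj zero (v ∷ v′ ∷ vs) zero → Unique (v ∷ v′ ∷ vs) →
      ∃₂ λ u us → Path Adj zero (u ∷ us) zero × u ∷ us ↭ v ∷ v′ ∷ vs × toℕ u ≡ k
    orient {v} {v′} {vs} path@(step adj _) uniq with start-neighbour adj
    ... | inj₁ v≡k = v , v′ ∷ vs , path , ↭-refl , v≡k
    -- `unfold-reverse` exhibits `v` as the last vertex of the reversed list, so its first vertex is
    -- the other neighbour of 0; `length-reverse` rules out that `reverse (v′ ∷ vs)` is empty.
    ... | inj₂ v≡k+1 with reverse (v ∷ v′ ∷ vs) | Path-reverse Adj-sym (v ∷ v′ ∷ vs) path
                        | ↭-reverse (v ∷ v′ ∷ vs) | reverse (v′ ∷ vs) | unfold-reverse v (v′ ∷ vs)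
                        | length-reverse (v′ ∷ vs)
    ...   | _ | path′@(step adj′ _) | perm | u ∷ us | refl | _ = u , _ , path′ , perm , u≡k
      where
        u≡k : toℕ u ≡ k
        u≡k with start-neighbour adj′ | Unique-resp-↭ (↭-sym perm) uniq
        ... | inj₁ eq | _      = eq
        ... | inj₂ eq | u∉ ∷ _ = contradiction (toℕ-injective (≡-trans eq (sym v≡k+1)))
                (All.lookup u∉ (∈-++⁺ʳ us (here refl)))

    -- The cut positions lie in rows 0 and k, so every arc leaving another vertex survives in the
    -- matrix.
    route-of-path : ∀ {u vs} → Path Adj u vs zero → All (λ a → a ≢ zero × toℕ a ≢ k) (u ∷ vs) →
      ∃ λ x → Route e zero u vs x
    route-of-path (close adj) ((u≢0 , u≢k) ∷ []) =
      _ , close (e-arc (u≢0 , [ u≢0 ∘ toℕ-injective ∘ proj₁ , u≢k ∘ proj₁ ]′ , adj))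
    route-of-path (step adj path) ((u≢0 , _) ∷ away@((v≢0 , _) ∷ _)) with route-of-path path away
    ... | x , route = _ , step (e-arc ((λ { refl → irrefl adj }) ,
            [ u≢0 ∘ toℕ-injective ∘ proj₁ , v≢0 ∘ toℕ-injective ∘ proj₂ ]′ , adj)) route

    -- The arcs leaving 0 and k are treated by hand: the first ends at k and not at k+1, and the
    -- second does not return to 0.
    route-of-closed-path : ∀ {v v′ vs} → Path Adj zero (v ∷ v′ ∷ vs) zero →
      Unique (zero ∷ v ∷ v′ ∷ vs) → toℕ v ≡ k → ∃ λ x → Route e zero zero (v ∷ v′ ∷ vs) x
    route-of-closed-path (step adj (step adj′ path)) ((0≢v ∷ 0≢v′ ∷ 0∉) ∷ v∉ ∷ _) v≡k
      with x , route ← route-of-path path (All.zipWith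
             (λ (0≢a , v≢a) → 0≢a ∘ sym , λ a≡k → v≢a (toℕ-injective (≡-trans v≡k (sym a≡k))))
             (0≢v′ ∷ 0∉ , v∉)) =
        _ , step (e-arc (0≢v , [ uncut , (λ (0≡k , _) → contradiction 0≡k (<⇒≢ 0<k)) ]′ , adj))
             (step (e-arc (All.head v∉ , [ 0≢v ∘ sym ∘ toℕ-injective ∘ proj₁ ,
                                           0≢v′ ∘ sym ∘ toℕ-injective ∘ proj₂ ]′ , adj′)) route)
      where
        uncut : ¬ (0 ≡ 0 × toℕ _ ≡ k + 1)
        uncut (_ , v≡k+1) = m+1+n≢m k (≡-trans (sym v≡k+1) v≡k)

    -- The neighbours of K fill the whole interval from k to 3k - 1; `u` is half the offset of `q`
    -- from k, rounded down.
    KNeighbour-exists : ∀ (q : V) → k ≤ toℕ q → toℕ q < 3 * k → ∃ λ (u : V) → toℕ u < k × KNeighbour k u q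
    KNeighbour-exists q k≤q q<3k with halve (toℕ q ℕ.∸ k)
    ... | i , i-half = u , subst (_< k) (sym u≡i) i<k ,
            [ (λ d≡ → inj₁ (position d≡)) ,
              (λ d≡ → inj₂ (≡-trans (position d≡) (sym (+-assoc k _ 1)))) ]′ i-half′
      where
        i<k : i < k
        i<k = *-cancelˡ-< 2 i k (≤-<-trans
          ([ (λ d≡ → ≤-reflexive (sym d≡)) ,
             (λ d≡ → ≤-trans (m≤m+n _ 1) (≤-reflexive (sym d≡))) ]′ i-half)
          (+-cancelˡ-< k _ _ (subst (_< 3 * k) (sym (m+[n∸m]≡n k≤q)) q<3k)))

        u : V
        u = fromℕ< (<-≤-trans i<k (≤-trans k≤3k 3k≤))

        u≡i : toℕ u ≡ i
        u≡i = toℕ-fromℕ< _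

        i-half′ : toℕ q ℕ.∸ k ≡ 2 * toℕ u ⊎ toℕ q ℕ.∸ k ≡ 2 * toℕ u + 1
        i-half′ = subst (λ j → toℕ q ℕ.∸ k ≡ 2 * j ⊎ toℕ q ℕ.∸ k ≡ 2 * j + 1) (sym u≡i) i-half

        position : ∀ {d} → toℕ q ℕ.∸ k ≡ d → toℕ q ≡ k + d
        position d≡ = ≡-trans (sym (m+[n∸m]≡n k≤q)) (cong (k +_) d≡)

    permanent-of-closed-path : ∀ {v v′ vs} → Path Adj zero (v ∷ v′ ∷ vs) zero →
      Unique (zero ∷ v ∷ v′ ∷ vs) → toℕ v ≡ k → (∀ (u : V) → toℕ u < k → u ∈ zero ∷ v ∷ v′ ∷ vs) →
      ∃ λ m → permanent e (indicator m) (tabulate id) (tabulate id) ≡ true × tMono (suc N) k ∣ₘ m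
    permanent-of-closed-path {v} {v′} {vs} path uniq v≡k covers
      with x , route@(step eq route′) ← route-of-closed-path path uniq v≡k
      with rs , perm ← complement (tabulate id) uniq (λ {u} _ → ∈-allFin u) =
        -- The monomial is that of the route alone, since the vertices in `rs` become fixed points
        -- with entry 1.
        x , ≡-trans (permanent-rows-↭ e (indicator x) (tabulate id) (↭-sym perm))
              (≡-trans (permanent-columns-↭ e (indicator x) (zero ∷ v ∷ v′ ∷ vs ++ rs) (↭-sym perm))
                (start-permanent eq route′ uniq-all (All.tabulate outside))) ,
        t∣x route
      where
        uniq-all : Unique ((zero ∷ v ∷ v′ ∷ vs) ++ rs)
        uniq-all = Unique-resp-↭ (↭-sym perm) (allFin⁺ (suc N))

        outside : ∀ {r} → r ∈ rs → 3 * k ≤ toℕ r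
        outside {r} r∈ = ≮⇒≥ λ r<3k → Unique-++-disjoint (zero ∷ v ∷ v′ ∷ vs) uniq-all (inside r<3k) r∈
          where
            inside : toℕ r < 3 * k → r ∈ zero ∷ v ∷ v′ ∷ vs
            inside r<3k with toℕ r <? k
            ... | yes r<k = covers r r<k
            ... | no r≮k with u , u<k , nb ← KNeighbour-exists r (≮⇒≥ r≮k) r<3k =
              proj₁ (neighbour-on-route route uniq (covers u u<k) u<k nb)

        t∣x : ∀ {x} → Route e zero zero (v ∷ v′ ∷ vs) x → tMono (suc N) k ∣ₘ x
        t∣x route u q with tMono-support k u q
        ... | inj₁ t≡0             = ≤-trans (≤-reflexive t≡0) z≤n
        ... | inj₂ (u<k , nb , t≡1) = ≤-trans (≤-reflexive t≡1)
                (proj₂ (neighbour-on-route route uniq (covers u u<k) u<k nb))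

    permanent-of-cycle : KCycle G k →
      ∃ λ m → permanent e (indicator m) (tabulate id) (tabulate id) ≡ true × tMono (suc N) k ∣ₘ m
    permanent-of-cycle (C , covers) with rotate-to-start C (covers zero 0<k)
    ... | [] , _ , perm = contradiction (↭-length perm) (<⇒≢ (s≤s (≤-trans (s≤s z≤n) (Cycle.long C))))
    ... | _ ∷ [] , _ , perm = contradiction (↭-length perm) (<⇒≢ (s≤s (Cycle.long C)))
    ... | v ∷ v′ ∷ vs , path , perm
      with uniq@(_ ∷ uniq′) ← Unique-resp-↭ (↭-sym perm) (Cycle.distinct C)
      with orient path uniq′
    ...   | u , [] , _ , perm′ , _ = contradiction (↭-length perm′) λ ()
    ...   | u , u′ ∷ us , path′ , perm′ , u≡k =
      permanent-of-closed-path path′ (Unique-resp-↭ (prep zero (↭-sym perm′)) uniq) u≡k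
        λ w w<k → ∈-resp-↭ (trans (↭-sym perm) (prep zero (↭-sym perm′))) (covers w w<k)

theorem7 : ∀ {c ℓ} (F : Field c ℓ) → HasCharTwo F →
    (n k : ℕ) → 1 < k → 3 * k ≤ n →
    (G : SimpleGraph n) →
    KIndependent G k → KNeighbourhoods G k → KNoCommonNeighbour G k →
    (KCycle G k ⇔
    Σ (Mono n) (λ m →
    (¬ (Field._≈_ F (Polynomials.coeff F m (Polynomials.det F (MG F G k))) (Field.0# F)))
    × (tMono n k ∣ₘ m)))
theorem7 F 1+1≈0 zero    k 1<k 3k≤0 G _ _ _ =
  contradiction (≤-trans 1<k (≤-trans (m≤m+n k (2 * k)) 3k≤0)) λ ()
theorem7 {c} {ℓ} F 1+1≈0 (suc N) k 1<k 3k≤n G _ nbhd _ = mk⇔ to from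
  where
    open Field F using (_≈_; 0#; 1≉0) renaming (sym to ≈-sym; trans to ≈-trans; reflexive to ≈-reflexive)
    open Polynomials F using (coeff; det)

    e : Fin (suc N) → Fin (suc N) → Maybe (Mono (suc N))
    e a b = proj₁ (MG-entry G k F a b)

    e-entry : ∀ a b → Entry G k a b (e a b)
    e-entry a b = proj₁ (proj₂ (MG-entry G k F a b))

    0<k : 0 < k
    0<k = ≤-trans (n≤1+n 1) 1<k

    coeff-MG : ∀ m {b} → permanent e (indicator m) (tabulate id) (tabulate id) ≡ b →
      coeff m (det (MG F G k)) ≈ embed F 1+1≈0 b
    coeff-MG m eq = ≈-trans
      (coeff-det F 1+1≈0 m (MG F G k) e (λ a b → proj₂ (proj₂ (MG-entry G k F a b))))
      (≈-reflexive (cong (embed F 1+1≈0) eq))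

    to : KCycle G k → Σ (Mono (suc N)) λ m → ¬ (coeff m (det (MG F G k)) ≈ 0#) × tMono (suc N) k ∣ₘ m
    to cycle with permanent-of-cycle G k e e-entry 0<k 3k≤n nbhd cycle
    ... | m , eq , t∣m = m , (λ zero-coeff → 1≉0 (≈-trans (≈-sym (coeff-MG m eq)) zero-coeff)) , t∣m

    from : (Σ (Mono (suc N)) λ m → ¬ (coeff m (det (MG F G k)) ≈ 0#) × tMono (suc N) k ∣ₘ m) → KCycle G k
    -- Equality in `F` is not assumed decidable; the case distinction is on the parity whose image
    -- in `F` is the coefficient.
    from (m , nonzero , t∣m) with permanent e (indicator m) (tabulate id) (tabulate id) in eq
    ... | true  = cycle-of-permanent G k e e-entry 0<k 3k≤n nbhd {m} t∣m eq
    ... | false = contradiction (coeff-MG m eq) nonzero
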